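{- Let $\alpha=[0;a_1,a_2,\ldots]\in\mathbf{Bad}$ and let $(p_n/q_n)_{n\ge1}$ be the sequence of its convergents. Assume that there exist a positive rational number $x$ and two sequences of finite words $(U_k)_{k\ge1}$ and $(V_k)_{k\ge1}$ over the positive integers such that, for every $k\ge1$, the sequence of partial quotients $a_1a_2\ldots$ of $\alpha$ begins with the word $V_kU_k\overline{U}_k$, and $|U_{k+1}|>|U_k|\ge x|V_k|$. Set $M=\limsup_{\ell\to+\infty}q_\ell^{1/\ell}$ and $m=\liminf_{\ell\to+\infty}q_\ell^{1/\ell}$. If $$x>\frac32\cdot\frac{\log M}{\log m}-\frac12,$$ then for every real number $\beta$ equal to $\alpha$ up to a rational homography one has $\inf_{q\ge1}q\cdot\Vert q\alpha\Vert\cdot\Vert q\beta\Vert=0$.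
   Context: For a real number $y$, $\Vert y\Vert$ denotes the distance from $y$ to the nearest integer. $\mathbf{Bad}=\{\alpha\in\mathbb{R} : \inf_{q\ge1} q\Vert q\alpha\Vert>0\}$ (equivalently, real numbers with bounded partial quotients). A finite word $W=w_1\ldots w_r$ over the positive integers is identified with the sequence of partial quotients $w_1,\ldots,w_r$; $|W|$ denotes its length and $\overline{W}=w_r\ldots w_1$ its mirror image. A real number $\beta$ is equal to $\alpha$ up to a rational homography if $\beta=(a\alpha+b)/(c\alpha+d)$ for some integers $a,b,c,d$ with $ad-bc\neq0$. -}

module Defs where

open import Data.Nat.Base as ℕ using (ℕ; zero; suc)
import Data.Nat.Properties as ℕ
open import Data.Integer.Base as ℤ using (ℤ; +_; 1ℤ)
import Data.Integer.Properties as ℤ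
import Data.Integer.DivMod as ℤ
open import Data.Rational.Base as ℚ using (ℚ; 0ℚ; 1ℚ; ½)
import Data.Rational.Properties as ℚ
open import Data.Rational.Solver using (module +-*-Solver)
open import Data.Rational.Unnormalised.Base as ℚᵘ using (ℚᵘ; mkℚᵘ)
import Data.Rational.Unnormalised.Properties as ℚᵘ
open import Data.Bool.Base using (true; false)
open import Data.List.Base using (List; length; applyUpTo)
open import Data.List.Relation.Unary.All using (All)
open import Data.Product.Base using (Σ; ∃; ∃-syntax; _×_; _,_; proj₁; proj₂)
open import Data.Sum.Base using (_⊎_; inj₁; inj₂)
open import Relation.Binary.Definitions using (tri<; tri≈; tri>)
open import Relation.Binary.PropositionalEquality

fromℤ : ℤ → ℚ
fromℤ i = i ℚ./ 1

fromℕ : ℕ → ℚ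
fromℕ n = fromℤ (+ n)

distℚ : ℚ → ℚ
distℚ p = ℚ.∣ p ℚ.- fromℤ (ℚ.round p) ∣

private
  module _ where
    open +-*-Solver

    swap₄ : ∀ a b c d → (a ℚ.+ b) ℚ.- (c ℚ.+ d) ≡ (a ℚ.- c) ℚ.+ (b ℚ.- d)
    swap₄ = solve 4 (λ a b c d → (a :+ b) :- (c :+ d) := (a :- c) :+ (b :- d)) refl

    neg-sub : ∀ a b → ℚ.- a ℚ.- (ℚ.- b) ≡ ℚ.- (a ℚ.- b)
    neg-sub = solve 2 (λ a b → :- a :- (:- b) := :- (a :- b)) refl

    sub-swap : ∀ a b → ℚ.- (a ℚ.- b) ≡ b ℚ.- a
    sub-swap = solve 2 (λ a b → :- (a :- b) := b :- a) refl

    sub-split : ∀ a b c → a ℚ.- c ≡ (a ℚ.- b) ℚ.+ (b ℚ.- c)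
    sub-split = solve 3 (λ a b c → a :- c := (a :- b) :+ (b :- c)) refl

    sub-add : ∀ a b → (a ℚ.- b) ℚ.+ b ≡ a
    sub-add = solve 2 (λ a b → (a :- b) :+ b := a) refl

    add-sub : ∀ a b → (a ℚ.+ b) ℚ.- b ≡ a
    add-sub = solve 2 (λ a b → (a :+ b) :- b := a) refl

    mul-split : ∀ a b c d →
      a ℚ.* b ℚ.- c ℚ.* d ≡ a ℚ.* (b ℚ.- d) ℚ.+ d ℚ.* (a ℚ.- c)
    mul-split = solve 4 (λ a b c d →
      a :* b :- c :* d := a :* (b :- d) :+ d :* (a :- c)) refl

    mul-add : ∀ a b c → a ℚ.* c ℚ.+ b ℚ.* c ≡ (a ℚ.+ b) ℚ.* c
    mul-add = solve 3 (λ a b c → a :* c :+ b :* c := (a :+ b) :* c) refl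

    neg-add : ∀ a b → ℚ.- (a ℚ.+ b) ≡ (ℚ.- a) ℚ.- b
    neg-add = solve 2 (λ a b → :- (a :+ b) := :- a :- b) refl

    sub-neg : ∀ a b → a ℚ.- (ℚ.- b) ≡ b ℚ.+ a
    sub-neg = solve 2 (λ a b → a :- (:- b) := b :+ a) refl

    halves : ∀ p h → p ℚ.* h ℚ.+ p ℚ.* h ≡ p ℚ.* (h ℚ.+ h)
    halves = solve 2 (λ p h → p :* h :+ p :* h := p :* (h :+ h)) refl

  ∣-∣-sym : ∀ a b → ℚ.∣ a ℚ.- b ∣ ≡ ℚ.∣ b ℚ.- a ∣
  ∣-∣-sym a b = trans (sym (ℚ.∣-p∣≡∣p∣ (a ℚ.- b))) (cong ℚ.∣_∣ (sub-swap a b))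

  p≤∣p∣ : ∀ p → p ℚ.≤ ℚ.∣ p ∣
  p≤∣p∣ p with ℚ.≤-total 0ℚ p
  ... | inj₁ 0≤p = ℚ.≤-reflexive (sym (ℚ.0≤p⇒∣p∣≡p 0≤p))
  ... | inj₂ p≤0 = ℚ.≤-trans p≤0 (ℚ.0≤∣p∣ p)

  -p≤∣p∣ : ∀ p → ℚ.- p ℚ.≤ ℚ.∣ p ∣
  -p≤∣p∣ p = subst (ℚ.- p ℚ.≤_) (ℚ.∣-p∣≡∣p∣ p) (p≤∣p∣ (ℚ.- p))

  ∣p∣≤ : ∀ {p b} → p ℚ.≤ b → ℚ.- p ℚ.≤ b → ℚ.∣ p ∣ ℚ.≤ b
  ∣p∣≤ {p} {b} p≤b -p≤b with ℚ.∣p∣≡p∨∣p∣≡-p p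
  ... | inj₁ eq = subst (ℚ._≤ b) (sym eq) p≤b
  ... | inj₂ eq = subst (ℚ._≤ b) (sym eq) -p≤b

  ≤+⇒-≤ : ∀ {a b c} → a ℚ.≤ c ℚ.+ b → a ℚ.- b ℚ.≤ c
  ≤+⇒-≤ {a} {b} {c} h =
    subst (a ℚ.- b ℚ.≤_) (add-sub c b) (ℚ.+-monoˡ-≤ (ℚ.- b) h)

  +≤⇒≤- : ∀ {a b c} → a ℚ.+ b ℚ.≤ c → a ℚ.≤ c ℚ.- b
  +≤⇒≤- {a} {b} {c} h =
    subst (ℚ._≤ c ℚ.- b) (add-sub a b) (ℚ.+-monoˡ-≤ (ℚ.- b) h)

  triangle : ∀ a b c → ℚ.∣ a ℚ.- c ∣ ℚ.≤ ℚ.∣ a ℚ.- b ∣ ℚ.+ ℚ.∣ b ℚ.- c ∣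
  triangle a b c = subst (λ t → ℚ.∣ t ∣ ℚ.≤ ℚ.∣ a ℚ.- b ∣ ℚ.+ ℚ.∣ b ℚ.- c ∣)
    (sym (sub-split a b c)) (ℚ.∣p+q∣≤∣p∣+∣q∣ (a ℚ.- b) (b ℚ.- c))

  reverse-triangle : ∀ a b → ℚ.∣ ℚ.∣ a ∣ ℚ.- ℚ.∣ b ∣ ∣ ℚ.≤ ℚ.∣ a ℚ.- b ∣
  reverse-triangle a b = ∣p∣≤ (≤+⇒-≤ (h a b))
    (subst₂ ℚ._≤_ (sym (sub-swap ℚ.∣ a ∣ ℚ.∣ b ∣)) (∣-∣-sym b a) (≤+⇒-≤ (h b a)))
    where
    h : ∀ a b → ℚ.∣ a ∣ ℚ.≤ ℚ.∣ a ℚ.- b ∣ ℚ.+ ℚ.∣ b ∣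
    h a b = subst (λ t → ℚ.∣ t ∣ ℚ.≤ ℚ.∣ a ℚ.- b ∣ ℚ.+ ℚ.∣ b ∣)
      (sub-add a b) (ℚ.∣p+q∣≤∣p∣+∣q∣ (a ℚ.- b) b)

  toℚᵘ-fromℤ : ∀ i → ℚ.toℚᵘ (fromℤ i) ℚᵘ.≃ mkℚᵘ i 0
  toℚᵘ-fromℤ i = ℚ.toℚᵘ-fromℚᵘ (mkℚᵘ i 0)

  fromℤ-mono-≤ : ∀ {i j} → i ℤ.≤ j → fromℤ i ℚ.≤ fromℤ j
  fromℤ-mono-≤ {i} {j} i≤j = ℚ.toℚᵘ-cancel-≤ (begin
    ℚ.toℚᵘ (fromℤ i) ≃⟨ toℚᵘ-fromℤ i ⟩
    mkℚᵘ i 0         ≤⟨ ℚᵘ.*≤* (ℤ.*-monoʳ-≤-nonNeg 1ℤ i≤j) ⟩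
    mkℚᵘ j 0         ≃⟨ toℚᵘ-fromℤ j ⟨
    ℚ.toℚᵘ (fromℤ j) ∎)
    where open ℚᵘ.≤-Reasoning

  fromℤ-suc : ∀ i → fromℤ (ℤ.suc i) ≡ 1ℚ ℚ.+ fromℤ i
  fromℤ-suc i = ℚ.toℚᵘ-injective (begin
    ℚ.toℚᵘ (fromℤ (ℤ.suc i))      ≈⟨ toℚᵘ-fromℤ (ℤ.suc i) ⟩
    mkℚᵘ (ℤ.suc i) 0              ≈⟨ ℚᵘ.*≡* (cong (ℤ._* 1ℤ) (cong (λ t → 1ℤ ℤ.+ t) (sym (ℤ.*-identityʳ i)))) ⟩
    ℚᵘ.1ℚᵘ ℚᵘ.+ mkℚᵘ i 0          ≈⟨ ℚᵘ.+-congʳ ℚᵘ.1ℚᵘ (toℚᵘ-fromℤ i) ⟨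
    ℚᵘ.1ℚᵘ ℚᵘ.+ ℚ.toℚᵘ (fromℤ i)  ≈⟨ ℚ.toℚᵘ-homo-+ 1ℚ (fromℤ i) ⟨
    ℚ.toℚᵘ (1ℚ ℚ.+ fromℤ i)       ∎)
    where open import Relation.Binary.Reasoning.Setoid ℚᵘ.≃-setoid

  fromℤ-neg : ∀ i → fromℤ (ℤ.- i) ≡ ℚ.- fromℤ i
  fromℤ-neg i = ℚ.toℚᵘ-injective (begin
    ℚ.toℚᵘ (fromℤ (ℤ.- i))   ≈⟨ toℚᵘ-fromℤ (ℤ.- i) ⟩
    ℚᵘ.- (mkℚᵘ i 0)          ≈⟨ ℚᵘ.-‿cong (toℚᵘ-fromℤ i) ⟨
    ℚᵘ.- ℚ.toℚᵘ (fromℤ i)    ≈⟨ ℚ.toℚᵘ-homo‿- (fromℤ i) ⟨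
    ℚ.toℚᵘ (ℚ.- fromℤ i)     ∎)
    where open import Relation.Binary.Reasoning.Setoid ℚᵘ.≃-setoid

  floor-≤ : ∀ p → fromℤ (ℚ.floor p) ℚ.≤ p
  floor-≤ p@record{} = ℚ.toℚᵘ-cancel-≤ (begin
    ℚ.toℚᵘ (fromℤ (ℚ.floor p)) ≃⟨ toℚᵘ-fromℤ (ℚ.floor p) ⟩
    mkℚᵘ (ℚ.floor p) 0         ≤⟨ ℚᵘ.*≤* (subst (ℚ.floor p ℤ.* ℚ.↧ p ℤ.≤_)
                                    (sym (ℤ.*-identityʳ (ℚ.↥ p))) (ℤ.[n/d]*d≤n (ℚ.↥ p) (ℚ.↧ p))) ⟩
    ℚ.toℚᵘ p                   ∎)
    where open ℚᵘ.≤-Reasoning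

  <-floor+1 : ∀ p → p ℚ.≤ 1ℚ ℚ.+ fromℤ (ℚ.floor p)
  <-floor+1 p@record{} = subst (p ℚ.≤_) (fromℤ-suc (ℚ.floor p)) (ℚ.toℚᵘ-cancel-≤ (begin
    ℚ.toℚᵘ p                             ≤⟨ ℚᵘ.*≤* (subst₂ ℤ._≤_ (sym (ℤ.*-identityʳ (ℚ.↥ p)))
                                              (cong (λ t → ℤ.suc t ℤ.* ℚ.↧ p)
                                                (sym (ℤ.div-pos-is-/ℕ (ℚ.↥ p) (ℚ.↧ₙ p))))
                                              (ℤ.<⇒≤ (ℤ.n<s[n/ℕd]*d (ℚ.↥ p) (ℚ.↧ₙ p)))) ⟩
    mkℚᵘ (ℤ.suc (ℚ.floor p)) 0           ≃⟨ toℚᵘ-fromℤ (ℤ.suc (ℚ.floor p)) ⟨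
    ℚ.toℚᵘ (fromℤ (ℤ.suc (ℚ.floor p)))   ∎))
    where open ℚᵘ.≤-Reasoning

  fromℤ-ceiling : ∀ p → fromℤ (ℚ.ceiling p) ≡ ℚ.- fromℤ (ℚ.floor (ℚ.- p))
  fromℤ-ceiling p@record{} = fromℤ-neg (ℚ.floor (ℚ.- p))

distℚ≤½ : ∀ p → distℚ p ℚ.≤ ½
distℚ≤½ p with p ℚ.≤ᵇ 0ℚ
... | false = ∣p∣≤
        (≤+⇒-≤ (subst₂ ℚ._≤_ (add-sub p ½) (shift f) (ℚ.+-monoˡ-≤ (ℚ.- ½) (<-floor+1 (p ℚ.+ ½)))))
        (subst (ℚ._≤ ½) (sym (sub-swap p f)) (≤+⇒-≤ (subst (f ℚ.≤_) (ℚ.+-comm p ½) (floor-≤ (p ℚ.+ ½)))))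
  where
  f = fromℤ (ℚ.floor (p ℚ.+ ½))
  shift : ∀ f → (1ℚ ℚ.+ f) ℚ.- ½ ≡ ½ ℚ.+ f
  shift f = trans (cong (λ t → t ℚ.- ½) (ℚ.+-comm 1ℚ f))
    (trans (ℚ.+-assoc f 1ℚ (ℚ.- ½)) (ℚ.+-comm f ½))
... | true = subst (λ t → ℚ.∣ p ℚ.- t ∣ ℚ.≤ ½) (sym (fromℤ-ceiling (p ℚ.- ½)))
        (subst (λ t → ℚ.∣ t ∣ ℚ.≤ ½) (sym (sub-neg p g)) (∣p∣≤ upper lower))
  where
  y = ℚ.- (p ℚ.- ½)
  g = fromℤ (ℚ.floor y)
  upper : g ℚ.+ p ℚ.≤ ½
  upper = subst (g ℚ.+ p ℚ.≤_) (trans (cong (ℚ._+ p) (sub-swap p ½)) (sub-add ½ p))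
            (ℚ.+-monoˡ-≤ p (floor-≤ y))
  lower : ℚ.- (g ℚ.+ p) ℚ.≤ ½
  lower = subst (ℚ._≤ ½) eq₁ (subst₂ ℚ._≤_ refl eq₂ (ℚ.+-monoˡ-≤ (ℚ.- (½ ℚ.+ g)) (<-floor+1 y)))
    where
    open +-*-Solver
    eq₁ : y ℚ.+ (ℚ.- (½ ℚ.+ g)) ≡ ℚ.- (g ℚ.+ p)
    eq₁ = solve 3 (λ p h g → :- (p :- h) :+ (:- (h :+ g)) := :- (g :+ p)) refl p ½ g
    eq₂ : (1ℚ ℚ.+ g) ℚ.+ (ℚ.- (½ ℚ.+ g)) ≡ ½
    eq₂ = solve 2 (λ h g → (h :+ h :+ g) :+ (:- (h :+ g)) := h) refl ½ g

distℚ-nearest : ∀ p i → distℚ p ℚ.≤ ℚ.∣ p ℚ.- fromℤ i ∣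
distℚ-nearest p i with ℤ.<-cmp i (ℚ.round p)
... | tri≈ _ refl _ = ℚ.≤-refl
... | tri> _ _ r<i = begin
    distℚ p                    ≤⟨ distℚ≤½ p ⟩
    1ℚ ℚ.- ½                   ≤⟨ +≤⇒≤- {½} {½} (ℚ.≤-refl) ⟩
    1ℚ ℚ.- ½                   ≤⟨ ℚ.+-monoʳ-≤ 1ℚ (ℚ.neg-antimono-≤
                                    (ℚ.≤-trans (p≤∣p∣ (p ℚ.- r)) (distℚ≤½ p))) ⟩
    1ℚ ℚ.- (p ℚ.- r)           ≡⟨ solve 3 (λ o p r → o :- (p :- r) := (o :+ r) :- p) refl 1ℚ p r ⟩
    (1ℚ ℚ.+ r) ℚ.- p           ≤⟨ ℚ.+-monoˡ-≤ (ℚ.- p) (subst (ℚ._≤ fromℤ i) (fromℤ-suc (ℚ.round p))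
                                    (fromℤ-mono-≤ (ℤ.i<j⇒suc[i]≤j r<i))) ⟩
    fromℤ i ℚ.- p              ≤⟨ p≤∣p∣ _ ⟩
    ℚ.∣ fromℤ i ℚ.- p ∣        ≡⟨ ∣-∣-sym (fromℤ i) p ⟩
    ℚ.∣ p ℚ.- fromℤ i ∣        ∎
  where
  open ℚ.≤-Reasoning
  open +-*-Solver
  r = fromℤ (ℚ.round p)
... | tri< i<r _ _ = begin
    distℚ p                    ≤⟨ distℚ≤½ p ⟩
    1ℚ ℚ.- ½                   ≤⟨ ℚ.+-monoʳ-≤ 1ℚ (ℚ.neg-antimono-≤
                                    (ℚ.≤-trans (-p≤∣p∣ (p ℚ.- r)) (distℚ≤½ p))) ⟩
    1ℚ ℚ.- (ℚ.- (p ℚ.- r))     ≡⟨ cong (λ t → 1ℚ ℚ.- t) (sub-swap p r) ⟩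
    1ℚ ℚ.- (r ℚ.- p)           ≡⟨ solve 3 (λ o p r → o :- (r :- p) := p :+ (o :- r)) refl 1ℚ p r ⟩
    p ℚ.+ (1ℚ ℚ.- r)           ≤⟨ ℚ.+-monoʳ-≤ p (ℚ.≤-trans
                                    (ℚ.≤-reflexive (sym (sub-swap r 1ℚ)))
                                    (ℚ.neg-antimono-≤ (+≤⇒≤- {fromℤ i} {1ℚ} {r}
                                      (subst (ℚ._≤ r) (trans (fromℤ-suc i) (ℚ.+-comm 1ℚ (fromℤ i)))
                                        (fromℤ-mono-≤ (ℤ.i<j⇒suc[i]≤j i<r)))))) ⟩
    p ℚ.- fromℤ i              ≤⟨ p≤∣p∣ _ ⟩
    ℚ.∣ p ℚ.- fromℤ i ∣        ∎
  where
  open ℚ.≤-Reasoning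
  open +-*-Solver
  r = fromℤ (ℚ.round p)

private
  distℚ-lipschitz : ∀ p q → ℚ.∣ distℚ p ℚ.- distℚ q ∣ ℚ.≤ ℚ.∣ p ℚ.- q ∣
  distℚ-lipschitz p q = ∣p∣≤ (≤+⇒-≤ (h p q))
    (subst₂ ℚ._≤_ (sym (sub-swap (distℚ p) (distℚ q))) (∣-∣-sym q p) (≤+⇒-≤ (h q p)))
    where
    h : ∀ p q → distℚ p ℚ.≤ ℚ.∣ p ℚ.- q ∣ ℚ.+ distℚ q
    h p q = ℚ.≤-trans (distℚ-nearest p (ℚ.round q)) (triangle p q (fromℤ (ℚ.round q)))

-- Real numbers: Cauchy sequences of rationals, equality being the
-- setoid relation _≃_.

IsCauchy : (ℕ → ℚ) → Set
IsCauchy s = ∀ ε → 0ℚ ℚ.< ε →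
  ∃[ N ] ∀ m n → N ℕ.≤ m → N ℕ.≤ n → ℚ.∣ s m ℚ.- s n ∣ ℚ.< ε

record ℝ : Set where
  constructor mkℝ
  field
    seq    : ℕ → ℚ
    cauchy : IsCauchy seq

open ℝ public

Eventually : (ℕ → Set) → Set
Eventually P = ∃[ N ] ∀ n → N ℕ.≤ n → P n

infix 4 _≃_ _<_ _≤_ _#_

_≃_ _<_ _≤_ _#_ : ℝ → ℝ → Set
x ≃ y = ∀ ε → 0ℚ ℚ.< ε → Eventually λ n → ℚ.∣ seq x n ℚ.- seq y n ∣ ℚ.< ε
x < y = ∃[ δ ] 0ℚ ℚ.< δ × Eventually λ n → seq x n ℚ.+ δ ℚ.≤ seq y n
x ≤ y = ∀ ε → 0ℚ ℚ.< ε → Eventually λ n → seq x n ℚ.≤ seq y n ℚ.+ ε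
x # y = x < y ⊎ y < x

ι : ℚ → ℝ
ι p = mkℝ (λ _ → p) λ ε 0<ε →
  0 , λ _ _ _ _ → subst (ℚ._< ε) (sym (cong ℚ.∣_∣ (ℚ.+-inverseʳ p))) 0<ε

private
  lift : (f : ℚ → ℚ) → (∀ p q → ℚ.∣ f p ℚ.- f q ∣ ℚ.≤ ℚ.∣ p ℚ.- q ∣) → ℝ → ℝ
  lift f lip x = mkℝ (λ n → f (seq x n)) λ ε 0<ε → let N , h = cauchy x ε 0<ε in
    N , λ m n N≤m N≤n → ℚ.≤-<-trans (lip (seq x m) (seq x n)) (h m n N≤m N≤n)

  0<p*q : ∀ {p q} → 0ℚ ℚ.< p → 0ℚ ℚ.< q → 0ℚ ℚ.< p ℚ.* q
  0<p*q {p} {q} 0<p 0<q = ℚ.positive⁻¹ (p ℚ.* q)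
    {{ℚ.pos*pos⇒pos p {{ℚ.positive 0<p}} q {{ℚ.positive 0<q}}}}

  half+half : ∀ ε → ε ℚ.* ½ ℚ.+ ε ℚ.* ½ ≡ ε
  half+half ε = trans (halves ε ½) (ℚ.*-identityʳ ε)

  bound : ∀ x → ∃[ B ] 0ℚ ℚ.< B × Eventually λ n → ℚ.∣ seq x n ∣ ℚ.≤ B
  bound x = let N , h = cauchy x 1ℚ (ℚ.positive⁻¹ 1ℚ) in
    1ℚ ℚ.+ ℚ.∣ seq x N ∣ ,
    ℚ.<-≤-trans (ℚ.positive⁻¹ 1ℚ) (subst (ℚ._≤ 1ℚ ℚ.+ ℚ.∣ seq x N ∣) (ℚ.+-identityʳ 1ℚ)
      (ℚ.+-monoʳ-≤ 1ℚ (ℚ.0≤∣p∣ (seq x N)))) ,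
    N , λ n N≤n → ℚ.≤-trans
      (subst (λ t → ℚ.∣ t ∣ ℚ.≤ ℚ.∣ seq x n ℚ.- seq x N ∣ ℚ.+ ℚ.∣ seq x N ∣)
        (sub-add (seq x n) (seq x N))
        (ℚ.∣p+q∣≤∣p∣+∣q∣ (seq x n ℚ.- seq x N) (seq x N)))
      (ℚ.+-monoˡ-≤ ℚ.∣ seq x N ∣ (ℚ.<⇒≤ (h n N N≤n ℕ.≤-refl)))

infixl 6 _+_ _-_
infixl 7 _*_
infix  8 -_
infixr 8 _^_

-_ : ℝ → ℝ
-_ = lift ℚ.-_ λ p q → ℚ.≤-reflexive
  (trans (cong ℚ.∣_∣ (neg-sub p q)) (ℚ.∣-p∣≡∣p∣ (p ℚ.- q)))

∣_∣ : ℝ → ℝ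
∣_∣ = lift ℚ.∣_∣ reverse-triangle

-- Distance to the nearest integer.  It is 1-Lipschitz on ℚ, hence may be
-- applied termwise to a Cauchy sequence.
∥_∥ : ℝ → ℝ
∥_∥ = lift distℚ distℚ-lipschitz

private
  +-cauchy : ∀ x y → IsCauchy λ n → seq x n ℚ.+ seq y n
  +-cauchy x y ε 0<ε = N ℕ.⊔ K , λ m n m≥ n≥ →
    let Δx = seq x m ℚ.- seq x n
        Δy = seq y m ℚ.- seq y n
    in begin-strict
      ℚ.∣ (seq x m ℚ.+ seq y m) ℚ.- (seq x n ℚ.+ seq y n) ∣
        ≡⟨ cong ℚ.∣_∣ (swap₄ (seq x m) (seq y m) (seq x n) (seq y n)) ⟩
      ℚ.∣ Δx ℚ.+ Δy ∣
        ≤⟨ ℚ.∣p+q∣≤∣p∣+∣q∣ Δx Δy ⟩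
      ℚ.∣ Δx ∣ ℚ.+ ℚ.∣ Δy ∣
        <⟨ ℚ.+-mono-< {ℚ.∣ Δx ∣} {η} {ℚ.∣ Δy ∣} {η}
             (h m n (ℕ.m⊔n≤o⇒m≤o N K m≥) (ℕ.m⊔n≤o⇒m≤o N K n≥))
             (k m n (ℕ.m⊔n≤o⇒n≤o N K m≥) (ℕ.m⊔n≤o⇒n≤o N K n≥)) ⟩
      η ℚ.+ η
        ≡⟨ half+half ε ⟩
      ε ∎
    where
    open ℚ.≤-Reasoning
    η = ε ℚ.* ½
    0<η : 0ℚ ℚ.< η
    0<η = 0<p*q {ε} {½} 0<ε (ℚ.positive⁻¹ ½)
    N = proj₁ (cauchy x η 0<η)
    h = proj₂ (cauchy x η 0<η)
    K = proj₁ (cauchy y η 0<η)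
    k = proj₂ (cauchy y η 0<η)

_+_ : ℝ → ℝ → ℝ
x + y = mkℝ (λ n → seq x n ℚ.+ seq y n) (+-cauchy x y)

_-_ : ℝ → ℝ → ℝ
x - y = x + (- y)

private
  quotient : ∀ D ε → 0ℚ ℚ.< D → 0ℚ ℚ.< ε → ∃[ η ] 0ℚ ℚ.< η × D ℚ.* η ≡ ε
  quotient D ε 0<D 0<ε =
    D⁻¹ ℚ.* ε ,
    0<p*q {D⁻¹} {ε} (ℚ.positive⁻¹ D⁻¹ {{ℚ.1/pos⇒pos D {{D-pos}}}}) 0<ε ,
    trans (sym (ℚ.*-assoc D D⁻¹ ε))
      (trans (cong (λ t → t ℚ.* ε) (ℚ.*-inverseʳ D {{D-nonZero}})) (ℚ.*-identityˡ ε))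
    where
    D-pos : ℚ.Positive D
    D-pos = ℚ.positive 0<D
    D-nonZero : ℚ.NonZero D
    D-nonZero = ℚ.pos⇒nonZero D {{D-pos}}
    D⁻¹ : ℚ
    D⁻¹ = (ℚ.1/ D) {{D-nonZero}}

  *-close : ∀ {B C η} a b c d → 0ℚ ℚ.< B → 0ℚ ℚ.< C →
    ℚ.∣ a ∣ ℚ.≤ B → ℚ.∣ d ∣ ℚ.≤ C →
    ℚ.∣ a ℚ.- c ∣ ℚ.< η → ℚ.∣ b ℚ.- d ∣ ℚ.< η →
    ℚ.∣ a ℚ.* b ℚ.- c ℚ.* d ∣ ℚ.< (B ℚ.+ C) ℚ.* η
  *-close {B} {C} {η} a b c d 0<B 0<C ∣a∣≤B ∣d∣≤C ∣a-c∣<η ∣b-d∣<η = begin-strict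
    ℚ.∣ a ℚ.* b ℚ.- c ℚ.* d ∣
      ≡⟨ cong ℚ.∣_∣ (mul-split a b c d) ⟩
    ℚ.∣ a ℚ.* (b ℚ.- d) ℚ.+ d ℚ.* (a ℚ.- c) ∣
      ≤⟨ ℚ.∣p+q∣≤∣p∣+∣q∣ (a ℚ.* (b ℚ.- d)) (d ℚ.* (a ℚ.- c)) ⟩
    ℚ.∣ a ℚ.* (b ℚ.- d) ∣ ℚ.+ ℚ.∣ d ℚ.* (a ℚ.- c) ∣
      <⟨ ℚ.+-mono-< {ℚ.∣ a ℚ.* (b ℚ.- d) ∣} {B ℚ.* η} {ℚ.∣ d ℚ.* (a ℚ.- c) ∣} {C ℚ.* η}
           (mono B a (b ℚ.- d) 0<B ∣a∣≤B ∣b-d∣<η)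
           (mono C d (a ℚ.- c) 0<C ∣d∣≤C ∣a-c∣<η) ⟩
    B ℚ.* η ℚ.+ C ℚ.* η
      ≡⟨ mul-add B C η ⟩
    (B ℚ.+ C) ℚ.* η ∎
    where
    open ℚ.≤-Reasoning
    mono : ∀ E u v → 0ℚ ℚ.< E → ℚ.∣ u ∣ ℚ.≤ E → ℚ.∣ v ∣ ℚ.< η →
           ℚ.∣ u ℚ.* v ∣ ℚ.< E ℚ.* η
    mono E u v 0<E u≤E v<η = begin-strict
      ℚ.∣ u ℚ.* v ∣          ≡⟨ ℚ.∣p*q∣≡∣p∣*∣q∣ u v ⟩
      ℚ.∣ u ∣ ℚ.* ℚ.∣ v ∣    ≤⟨ ℚ.*-monoʳ-≤-nonNeg ℚ.∣ v ∣ {{ℚ.∣-∣-nonNeg v}} u≤E ⟩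
      E ℚ.* ℚ.∣ v ∣          <⟨ ℚ.*-monoʳ-<-pos E {{ℚ.positive 0<E}} v<η ⟩
      E ℚ.* η                ∎

  *-cauchy : ∀ x y → IsCauchy λ n → seq x n ℚ.* seq y n
  *-cauchy x y ε 0<ε =
    let B , 0<B , N₁ , b = bound x
        C , 0<C , N₂ , c = bound y
        η , 0<η , Dη≡ε = quotient (B ℚ.+ C) ε (ℚ.+-mono-< {0ℚ} {B} {0ℚ} {C} 0<B 0<C) 0<ε
        N₃ , h = cauchy x η 0<η
        N₄ , k = cauchy y η 0<η
        L = N₁ ℕ.⊔ N₂
        R = N₃ ℕ.⊔ N₄
    in L ℕ.⊔ R , λ m n m≥ n≥ →
      let m≥L = ℕ.m⊔n≤o⇒m≤o L R m≥
          n≥L = ℕ.m⊔n≤o⇒m≤o L R n≥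
          m≥R = ℕ.m⊔n≤o⇒n≤o L R m≥
          n≥R = ℕ.m⊔n≤o⇒n≤o L R n≥
      in subst (λ t → ℚ.∣ seq x m ℚ.* seq y m ℚ.- seq x n ℚ.* seq y n ∣ ℚ.< t) Dη≡ε
        (*-close (seq x m) (seq y m) (seq x n) (seq y n) 0<B 0<C
          (b m (ℕ.m⊔n≤o⇒m≤o N₁ N₂ m≥L)) (c n (ℕ.m⊔n≤o⇒n≤o N₁ N₂ n≥L))
          (h m n (ℕ.m⊔n≤o⇒m≤o N₃ N₄ m≥R) (ℕ.m⊔n≤o⇒m≤o N₃ N₄ n≥R))
          (k m n (ℕ.m⊔n≤o⇒n≤o N₃ N₄ m≥R) (ℕ.m⊔n≤o⇒n≤o N₃ N₄ n≥R)))

_*_ : ℝ → ℝ → ℝ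
x * y = mkℝ (λ n → seq x n ℚ.* seq y n) (*-cauchy x y)

_^_ : ℝ → ℕ → ℝ
x ^ zero  = ι 1ℚ
x ^ suc n = x * x ^ n

-- x / y = z
IsQuotient : (x y z : ℝ) → Set
IsQuotient x y z = y # ι 0ℚ × z * y ≃ x

Converges : (ℕ → ℝ) → ℝ → Set
Converges s x = ∀ ε → 0ℚ ℚ.< ε → Eventually λ n → ∣ s n - x ∣ < ι ε

IsLimsup IsLiminf : (ℕ → ℝ) → ℝ → Set
IsLimsup s M = ∀ ε → 0ℚ ℚ.< ε →
  Eventually (λ n → s n < M + ι ε) × (∀ N → ∃[ n ] N ℕ.≤ n × M - ι ε < s n)
IsLiminf s m = ∀ ε → 0ℚ ℚ.< ε →
  Eventually (λ n → m - ι ε < s n) × (∀ N → ∃[ n ] N ℕ.≤ n × s n < m + ι ε)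

-- i = inf_{q ≥ 1} f q
IsInf : (ℕ → ℝ) → ℝ → Set
IsInf f i =
  (∀ q → 1 ℕ.≤ q → i ≤ f q) ×
  (∀ ε → 0ℚ ℚ.< ε → ∃[ q ] 1 ℕ.≤ q × f q < i + ι ε)

-- inf_{q ≥ 1} f q > 0, as the existence of a positive lower bound, so that
-- the infimum need not exist as a (located) real.
InfPositive : (ℕ → ℝ) → Set
InfPositive f = ∃[ c ] 0ℚ ℚ.< c × ∀ q → 1 ℕ.≤ q → ι c ≤ f q

-- r = y ^ (1 / n), for n ≥ 1 and y ≥ 0
IsRoot : ℕ → ℝ → ℝ → Set
IsRoot n y r = ι 0ℚ ≤ r × r ^ n ≃ y

-- y = exp x = lim (1 + x / n) ^ n; the index is shifted to avoid n = 0.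
IsExp : (x y : ℝ) → Set
IsExp x y = Converges (λ n → (ι 1ℚ + x * ι (1ℤ ℚ./ suc n)) ^ suc n) y

-- L = log y
IsLog : (y L : ℝ) → Set
IsLog y L = IsExp L y

-- Continued fractions.  A sequence a : ℕ → ℕ stands for the partial
-- quotients a 1, a 2, … of [0; a 1, a 2, …]; the value a 0 is ignored.

-- num a n / den a n is the n-th convergent p_n / q_n.
num : (ℕ → ℕ) → ℕ → ℕ
num a 0             = 0
num a 1             = 1
num a (suc (suc n)) = a (suc (suc n)) ℕ.* num a (suc n) ℕ.+ num a n

den : (ℕ → ℕ) → ℕ → ℕ
den a 0             = 1
den a 1             = a 1
den a (suc (suc n)) = a (suc (suc n)) ℕ.* den a (suc n) ℕ.+ den a n

PositiveQuotients : (ℕ → ℕ) → Set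
PositiveQuotients a = ∀ n → 1 ℕ.≤ n → ℕ.NonZero (a n)

den-nonZero : ∀ a → PositiveQuotients a → ∀ n → ℕ.NonZero (den a n)
den-nonZero a a>0 0 = _
den-nonZero a a>0 1 = a>0 1 ℕ.≤-refl
den-nonZero a a>0 (suc (suc n)) = ℕ.>-nonZero (ℕ.≤-trans
  (ℕ.>-nonZero⁻¹ (den a n) {{den-nonZero a a>0 n}})
  (ℕ.m≤n+m (den a n) (a (suc (suc n)) ℕ.* den a (suc n))))

convergent : ∀ a → PositiveQuotients a → ℕ → ℚ
convergent a a>0 n = ((+ num a n) ℚ./ den a n) {{den-nonZero a a>0 n}}

-- α = [0; a 1, a 2, …]
IsContinuedFraction : (ℕ → ℕ) → ℝ → Set
IsContinuedFraction a α =
  Σ (PositiveQuotients a) λ a>0 → Converges (λ n → ι (convergent a a>0 n)) α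

IsWord : List ℕ → Set
IsWord = All ℕ.NonZero

BeginsWith : (ℕ → ℕ) → List ℕ → Set
BeginsWith a W = W ≡ applyUpTo (λ i → a (suc i)) (length W)

Bad : ℝ → Set
Bad α = InfPositive λ q → ι (fromℕ q) * ∥ ι (fromℕ q) * α ∥

-- β = (a α + b) / (c α + d)
EqualUpToHomography : (β α : ℝ) → Set
EqualUpToHomography β α = ∃[ a ] ∃[ b ] ∃[ c ] ∃[ d ]
  a ℤ.* d ℤ.- b ℤ.* c ≢ ℤ.0ℤ ×
  IsQuotient (ι (fromℤ a) * α + ι (fromℤ b)) (ι (fromℤ c) * α + ι (fromℤ d)) β

{-# OPTIONS --safe #-}
-- Let r = |V|, s = |U|, N = r + 2s, and let T(W) be the product of the
-- matrices [[w,1],[1,0]] over the letters w of W.  The matrix T(U Ū) is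
-- symmetric, hence so is T(V) T(U Ū) T(V)ᵀ = [[Q,P],[P,R]].  Its columns are
-- combinations of (q_N, p_N) and (q_{N-1}, p_{N-1}) with coefficients at most
-- q_r, so |Qα - P| and |Pα - R| are at most 4 q_r / q_N, while Q ≤ 2 q_r q_N.
-- If β = (aα + b)/(cα + d), the integer X = cP + dQ makes Xα close to cR + dP
-- and Xβ close to aP + bQ with errors of the same order, so that
-- |X| ‖Xα‖ ‖Xβ‖ = O(q_r³ / q_N).  This tends to 0: q_r ≤ C M′^r and
-- q_N ≥ m′^N for suitable M′ > M and m′ < m, and the hypothesis on x says
-- that (r + 2s) log m′ exceeds 3r log M′ by a positive multiple of s.
module Submission where

open import Data.Nat.Base as ℕ using (ℕ; suc)
open import Data.Integer.Base using (+_)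
open import Data.Rational.Base as ℚ using (ℚ; 0ℚ; ½)
open import Data.List.Base using (List; length; reverse; _++_)
open import Data.Product.Base using (∃-syntax; _×_; _,_; proj₁; proj₂)
open import Relation.Binary.PropositionalEquality

-- The order on these reals is not decidable and exp is given only as the limit of (1 + L / n)ⁿ. The
-- estimates are therefore made on rational terms at a common index, with natural exponents, and an
-- inequality between multiples of log M and log m is used only through matched approximants of M
-- and m. Write x = e / f. The hypothesis then reads 3 f log M < (2 e + f) log m, and multiplying by
-- a large c widens the gap to at least three units of log m. With A = 3 f c these units are spent
-- one by one below (2 e + f) c: one absorbs the error in the equation ratio · log m = log M, one
-- buys room between M, m and their rational replacements, and one leaves the factor m′ˢ that beats
-- every constant in the comparison of q_r³ with q_N. The sign of log m is also at issue: the
-- quotient supplies its apartness from 0, and q_n ≥ 1 decides for the positive side. Finally X must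
-- not vanish. If X = 0, then |cα + d| would be at most 4 |c| q_r / (Q q_N), whereas the division in
-- the homography keeps cα + d away from 0.

module Continuants where

  -- Continuants as a matrix action, and palindromes.

  open import Data.Nat.Base
  open import Data.Nat.Properties
  open import Data.Nat.Solver using (module +-*-Solver)
  open import Data.List.Base using ([]; _∷_; applyUpTo; foldl; foldr)
  open import Data.List.Properties
  open import Function.Base using (flip; _∘_)
  open import Defs using (num; den; PositiveQuotients; den-nonZero; BeginsWith)

  -- q_{n-1} and p_{n-1}, with q_{-1} = 0 and p_{-1} = 1.
  den⁻ num⁻ : (ℕ → ℕ) → ℕ → ℕ
  den⁻ a zero    = 0
  den⁻ a (suc n) = den a n
  num⁻ a zero    = 1
  num⁻ a (suc n) = num a n

  den-suc : ∀ a n → den a (suc n) ≡ a (suc n) * den a n + den⁻ a n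
  den-suc a zero    = sym (trans (+-identityʳ _) (*-identityʳ _))
  den-suc a (suc n) = refl

  num-suc : ∀ a n → num a (suc n) ≡ a (suc n) * num a n + num⁻ a n
  num-suc a zero    = sym (cong (_+ 1) (*-zeroʳ (a 1)))
  num-suc a (suc n) = refl

  -- The action of the symmetric matrix [[w,1],[1,0]].  Row vectors are
  -- multiplied by the matrix of a word from the left end (foldl), column
  -- vectors from the right end (foldr).
  step : ℕ → ℕ × ℕ → ℕ × ℕ
  step w (u , v) = w * u + v , u

  _⊙_ : ℕ × ℕ → List ℕ → ℕ × ℕ
  _⊙_ = foldl (flip step)

  ⟨_,_⟩ : ℕ × ℕ → ℕ × ℕ → ℕ
  ⟨ (u₁ , u₂) , (v₁ , v₂) ⟩ = u₁ * v₁ + u₂ * v₂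

  ⟨,⟩-comm : ∀ u v → ⟨ u , v ⟩ ≡ ⟨ v , u ⟩
  ⟨,⟩-comm (u₁ , u₂) (v₁ , v₂) = cong₂ _+_ (*-comm u₁ v₁) (*-comm u₂ v₂)

  step-adjoint : ∀ w u v → ⟨ step w u , v ⟩ ≡ ⟨ u , step w v ⟩
  step-adjoint w (u₁ , u₂) (v₁ , v₂) =
    solve 5 (λ w u₁ u₂ v₁ v₂ → (w :* u₁ :+ u₂) :* v₁ :+ u₁ :* v₂
      := u₁ :* (w :* v₁ :+ v₂) :+ u₂ :* v₁) refl w u₁ u₂ v₁ v₂
    where open +-*-Solver

  ⊙-adjoint : ∀ u W v → ⟨ u ⊙ W , v ⟩ ≡ ⟨ u , foldr step v W ⟩
  ⊙-adjoint u []      v = refl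
  ⊙-adjoint u (w ∷ W) v = trans (⊙-adjoint (step w u) W v) (step-adjoint w u (foldr step v W))

  -- This is transposition: the transpose of T(W) is T(`reverse W`). The symmetric letter matrices
  -- cross the pairing one at a time, which turns the row action of a word into its column action,
  -- and the column action of `reverse W` is the row action of W.
  ⊙-reverse : ∀ u W v → ⟨ u ⊙ reverse W , v ⟩ ≡ ⟨ u , v ⊙ W ⟩
  ⊙-reverse u W v = trans (⊙-adjoint u (reverse W) v) (cong (λ t → ⟨ u , t ⟩) (reverse-foldr step v W))

  -- The matrix of a palindrome is symmetric, hence so is its congruence transform.
  ⊙-palindrome : ∀ u v W → ⟨ u ⊙ (W ++ reverse W) , v ⟩ ≡ ⟨ v ⊙ (W ++ reverse W) , u ⟩
  ⊙-palindrome u v W = begin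
    ⟨ u ⊙ (W ++ reverse W) , v ⟩   ≡⟨ cong (λ t → ⟨ t , v ⟩) (foldl-++ (flip step) u W (reverse W)) ⟩
    ⟨ (u ⊙ W) ⊙ reverse W , v ⟩    ≡⟨ ⊙-reverse (u ⊙ W) W v ⟩
    ⟨ u ⊙ W , v ⊙ W ⟩              ≡⟨ ⟨,⟩-comm (u ⊙ W) (v ⊙ W) ⟩
    ⟨ v ⊙ W , u ⊙ W ⟩              ≡⟨ ⊙-reverse (v ⊙ W) W u ⟨
    ⟨ (v ⊙ W) ⊙ reverse W , u ⟩    ≡⟨ cong (λ t → ⟨ t , u ⟩) (foldl-++ (flip step) v W (reverse W)) ⟨
    ⟨ v ⊙ (W ++ reverse W) , u ⟩   ∎
    where open ≡-Reasoning

  prefix : (ℕ → ℕ) → ℕ → List ℕ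
  prefix a = applyUpTo (a ∘ suc)

  ⊙-prefix-suc : ∀ u a n → u ⊙ prefix a (suc n) ≡ step (a (suc n)) (u ⊙ prefix a n)
  ⊙-prefix-suc u a n = trans (cong (u ⊙_) (sym (applyUpTo-∷ʳ (a ∘ suc) n)))
    (foldl-∷ʳ (flip step) u (a (suc n)) (prefix a n))

  den-⊙ : ∀ a n → (1 , 0) ⊙ prefix a n ≡ (den a n , den⁻ a n)
  den-⊙ a zero    = refl
  den-⊙ a (suc n) = trans (⊙-prefix-suc (1 , 0) a n)
    (trans (cong (step (a (suc n))) (den-⊙ a n)) (cong (_, den a n) (sym (den-suc a n))))

  num-⊙ : ∀ a n → (0 , 1) ⊙ prefix a n ≡ (num a n , num⁻ a n)
  num-⊙ a zero    = refl
  num-⊙ a (suc n) = trans (⊙-prefix-suc (0 , 1) a n)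
    (trans (cong (step (a (suc n))) (num-⊙ a n)) (cong (_, num a n) (sym (num-suc a n))))

  beginsWith-++ : ∀ a V {W} → BeginsWith a (V ++ W) → BeginsWith a V
  beginsWith-++ a []      h = refl
  beginsWith-++ a (v ∷ V) h =
    cong₂ _∷_ (∷-injectiveˡ h) (beginsWith-++ (a ∘ suc) V (∷-injectiveʳ h))

  -- Equality of the two off-diagonal entries of T(V) T(U Ū) T(V)ᵀ. The first two factors multiply
  -- to the matrix with rows (q_N, q_{N-1}) and (p_N, p_{N-1}); the last has columns (q_r, q_{r-1})
  -- and (p_r, p_{r-1}).
  SymmetricAt : (ℕ → ℕ) → ℕ → ℕ → Set
  SymmetricAt a r N = num a r * den a N + num⁻ a r * den⁻ a N ≡ den a r * num a N + den⁻ a r * num⁻ a N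

  palindrome-symmetry : ∀ a V U → BeginsWith a (V ++ U ++ reverse U) →
    SymmetricAt a (length V) (length V + (length U + length U))
  palindrome-symmetry a V U h = begin
    ⟨ (num a r , num⁻ a r) , (den a N , den⁻ a N) ⟩  ≡⟨ ⟨,⟩-comm _ (den a N , den⁻ a N) ⟩
    ⟨ (den a N , den⁻ a N) , (num a r , num⁻ a r) ⟩  ≡⟨ cong₂ ⟨_,_⟩ (whole (1 , 0) (den-⊙ a)) (start (0 , 1) (num-⊙ a)) ⟩
    ⟨ ((1 , 0) ⊙ V) ⊙ P , (0 , 1) ⊙ V ⟩              ≡⟨ ⊙-palindrome ((1 , 0) ⊙ V) ((0 , 1) ⊙ V) U ⟩
    ⟨ ((0 , 1) ⊙ V) ⊙ P , (1 , 0) ⊙ V ⟩              ≡⟨ cong₂ ⟨_,_⟩ (whole (0 , 1) (num-⊙ a)) (start (1 , 0) (den-⊙ a)) ⟨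
    ⟨ (num a N , num⁻ a N) , (den a r , den⁻ a r) ⟩  ≡⟨ ⟨,⟩-comm _ (den a r , den⁻ a r) ⟩
    ⟨ (den a r , den⁻ a r) , (num a N , num⁻ a N) ⟩  ∎
    where
    open ≡-Reasoning
    P = U ++ reverse U
    r = length V
    N = r + (length U + length U)
    length≡ : length (V ++ P) ≡ N
    length≡ = trans (length-++ V) (cong (_+_ r)
      (trans (length-++ U) (cong (_+_ (length U)) (length-reverse U))))
    start : ∀ u {x y : ℕ → ℕ} → (∀ n → u ⊙ prefix a n ≡ (x n , y n)) → (x r , y r) ≡ u ⊙ V
    start u eq = trans (sym (eq r)) (cong (u ⊙_) (sym (beginsWith-++ a V h)))
    whole : ∀ u {x y : ℕ → ℕ} → (∀ n → u ⊙ prefix a n ≡ (x n , y n)) → (x N , y N) ≡ (u ⊙ V) ⊙ P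
    whole u eq = trans (sym (eq N)) (trans (cong (λ n → u ⊙ prefix a n) (sym length≡))
      (trans (cong (u ⊙_) (sym h)) (foldl-++ (flip step) u V P)))

  -- Monotonicity and comparison of numerators and denominators.

  module _ (a : ℕ → ℕ) (a>0 : PositiveQuotients a) where

    1≤den : ∀ n → 1 ≤ den a n
    1≤den n = >-nonZero⁻¹ (den a n) {{den-nonZero a a>0 n}}

    den≤den-suc : ∀ n → den a n ≤ den a (suc n)
    den≤den-suc n = begin
      den a n                             ≤⟨ m≤n*m (den a n) (a (suc n)) {{a>0 (suc n) (s≤s z≤n)}} ⟩
      a (suc n) * den a n                 ≤⟨ m≤m+n _ (den⁻ a n) ⟩
      a (suc n) * den a n + den⁻ a n      ≡⟨ den-suc a n ⟨
      den a (suc n)                       ∎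
      where open ≤-Reasoning

    den⁻≤den : ∀ n → den⁻ a n ≤ den a n
    den⁻≤den zero    = z≤n
    den⁻≤den (suc n) = den≤den-suc n

    den-mono-≤ : ∀ {m n} → m ≤ n → den a m ≤ den a n
    den-mono-≤ m≤n = go (≤⇒≤′ m≤n)
      where
      go : ∀ {m n} → m ≤′ n → den a m ≤ den a n
      go ≤′-refl       = ≤-refl
      go {n = suc n} (≤′-step m≤n) = ≤-trans (go m≤n) (den≤den-suc n)

    num≤den : ∀ n → num a n ≤ den a n
    num≤den 0             = z≤n
    num≤den 1             = 1≤den 1
    num≤den (suc (suc n)) = +-mono-≤ (*-monoʳ-≤ (a (2 + n)) (num≤den (suc n))) (num≤den n)

    -- The bound is by `den` because `den⁻` fails at n = 0, where `num⁻` is 1 and `den⁻` is 0. This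
    -- case occurs when V is empty.
    num⁻≤den : ∀ n → num⁻ a n ≤ den a n
    num⁻≤den zero    = ≤-refl
    num⁻≤den (suc n) = ≤-trans (num≤den n) (den≤den-suc n)

  -- With g = f s - e r the right side equals (2 e + f) c e r + 2 e c g. The unit by which B falls
  -- short of (2 e + f) c leaves e r, and e r + 2 e c g ≥ e r + g = f s ≥ s. In `growth` this
  -- surplus s becomes the factor mˢ.
  exponent-≤ : ∀ e f c B r s .{{_ : NonZero e}} .{{_ : NonZero f}} .{{_ : NonZero c}} →
    suc B ≡ (2 * e + f) * c → e * r ≤ f * s →
    B * r * e + s ≤ (r + (s + s)) * (e * f * c)
  exponent-≤ e f c B r s B≡ er≤fs = +-cancelʳ-≤ (e * r) _ _ (begin
    B * r * e + s + e * r                                 ≡⟨ solve 4 (λ e r s B → B :* r :* e :+ s :+ e :* r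
                                                              := (con 1 :+ B) :* (e :* r) :+ s) refl e r s B ⟩
    suc B * (e * r) + s                                   ≡⟨ cong (λ t → t * (e * r) + s) B≡ ⟩
    (2 * e + f) * c * (e * r) + s                         ≤⟨ +-monoʳ-≤ ((2 * e + f) * c * (e * r)) s≤ ⟩
    (2 * e + f) * c * (e * r) + (e * r + 2 * e * c * g)   ≡⟨ solve 5 (λ e f c r g →
                                                              (con 2 :* e :+ f) :* c :* (e :* r) :+ (e :* r :+ con 2 :* e :* c :* g)
                                                              := r :* (e :* f :* c) :+ con 2 :* (e :* c) :* (e :* r :+ g) :+ e :* r)
                                                              refl e f c r g ⟩
    r * (e * f * c) + 2 * (e * c) * (e * r + g) + e * r   ≡⟨ cong (λ t → r * (e * f * c) + 2 * (e * c) * t + e * r) er+g≡fs ⟩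
    r * (e * f * c) + 2 * (e * c) * (f * s) + e * r       ≡⟨ solve 5 (λ e f c r s →
                                                              r :* (e :* f :* c) :+ con 2 :* (e :* c) :* (f :* s) :+ e :* r
                                                              := (r :+ (s :+ s)) :* (e :* f :* c) :+ e :* r) refl e f c r s ⟩
    (r + (s + s)) * (e * f * c) + e * r                   ∎)
    where
    open ≤-Reasoning
    open +-*-Solver
    g = f * s ∸ e * r
    er+g≡fs : e * r + g ≡ f * s
    er+g≡fs = m+[n∸m]≡n er≤fs
    s≤ : s ≤ e * r + 2 * e * c * g
    s≤ = begin
      s                        ≤⟨ m≤n*m s f ⟩
      f * s                    ≡⟨ er+g≡fs ⟨
      e * r + g                ≤⟨ +-monoʳ-≤ (e * r) (m≤n*m g (2 * e * c) {{m*n≢0 (2 * e) c {{m*n≢0 2 e}}}}) ⟩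
      e * r + 2 * e * c * g    ∎

  cube-exponent : ∀ r e f c → r * 3 * (e * f * c) ≡ 3 * f * c * (r * e)
  cube-exponent = solve 4 (λ r e f c → r :* con 3 :* (e :* f :* c) := con 3 :* f :* c :* (r :* e)) refl
    where open +-*-Solver

module Estimates where

  open import Algebra.Bundles using (CommutativeRing)
  open import Data.Nat.Base using (zero)
  import Data.Nat.Properties as ℕ
  open import Data.Integer.Base as ℤ using (ℤ; -[1+_]; 1ℤ)
  import Data.Integer.Properties as ℤ
  open import Data.Rational.Base
  open import Data.Rational.Properties
  open import Data.Rational.Solver using (module +-*-Solver)
  open import Data.Rational.Unnormalised.Base as ℚᵘ using (mkℚᵘ)
  import Data.Rational.Unnormalised.Properties as ℚᵘ
  open import Data.Product.Base using (∃)
  open import Data.Sum.Base using (inj₁; inj₂)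
  open import Relation.Nullary.Decidable using (yes; no)
  open import Relation.Nullary.Negation using (contradiction)
  open import Algebra.Properties.CommutativeSemiring.Exp
    (CommutativeRing.commutativeSemiring +-*-commutativeRing)
  open import Defs using
    ( fromℤ; fromℕ; distℚ; distℚ-nearest; ℝ; seq; cauchy; ι; Eventually; Converges; _#_; ∥_∥
    ; IsLimsup; IsLiminf; IsRoot; IsQuotient; IsLog; IsContinuedFraction; EqualUpToHomography
    ; num; den; den-nonZero; convergent; PositiveQuotients; BeginsWith )
  import Defs as ℝ
  open Continuants
  open +-*-Solver

  -- Ordered field lemmas, casts and powers

  p≤q⇒0≤q-p : ∀ {p q} → p ≤ q → 0ℚ ≤ q - p
  p≤q⇒0≤q-p {p} {q} p≤q = subst (_≤ q - p) (+-inverseʳ p) (+-monoˡ-≤ (- p) p≤q)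

  p<q⇒0<q-p : ∀ {p q} → p < q → 0ℚ < q - p
  p<q⇒0<q-p {p} {q} p<q = subst (_< q - p) (+-inverseʳ p) (+-monoˡ-< (- p) p<q)

  ≤-by : ∀ {p q} d → 0ℚ ≤ d → p + d ≡ q → p ≤ q
  ≤-by {p} d 0≤d eq = subst₂ _≤_ (+-identityʳ p) eq (+-monoʳ-≤ p 0≤d)

  <-by : ∀ {p q} d → 0ℚ < d → p + d ≡ q → p < q
  <-by {p} d 0<d eq = subst₂ _<_ (+-identityʳ p) eq (+-monoʳ-< p 0<d)

  0≤p+q : ∀ {p q} → 0ℚ ≤ p → 0ℚ ≤ q → 0ℚ ≤ p + q
  0≤p+q {p} {q} = +-mono-≤ {0ℚ} {p} {0ℚ} {q}

  0<p+q : ∀ {p q} → 0ℚ < p → 0ℚ ≤ q → 0ℚ < p + q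
  0<p+q {p} {q} = +-mono-<-≤ {0ℚ} {p} {0ℚ} {q}

  0≤p*q : ∀ {p q} → 0ℚ ≤ p → 0ℚ ≤ q → 0ℚ ≤ p * q
  0≤p*q {p} {q} 0≤p 0≤q = nonNegative⁻¹ (p * q)
    {{nonNeg*nonNeg⇒nonNeg p {{nonNegative 0≤p}} q {{nonNegative 0≤q}}}}

  0<p*q : ∀ {p q} → 0ℚ < p → 0ℚ < q → 0ℚ < p * q
  0<p*q {p} {q} 0<p 0<q = positive⁻¹ (p * q)
    {{pos*pos⇒pos p {{positive 0<p}} q {{positive 0<q}}}}

  *-mono-≤ : ∀ {p q r s} → 0ℚ ≤ p → p ≤ q → 0ℚ ≤ r → r ≤ s → p * r ≤ q * s
  *-mono-≤ {p} {q} {r} {s} 0≤p p≤q 0≤r r≤s = ≤-trans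
    (*-monoʳ-≤-nonNeg r {{nonNegative 0≤r}} p≤q)
    (*-monoˡ-≤-nonNeg q {{nonNegative (≤-trans 0≤p p≤q)}} r≤s)

  *-monoˡ-≤ : ∀ {p q r} → 0ℚ ≤ p → q ≤ r → p * q ≤ p * r
  *-monoˡ-≤ {p} 0≤p = *-monoˡ-≤-nonNeg p {{nonNegative 0≤p}}

  *-monoʳ-≤ : ∀ {p q r} → 0ℚ ≤ p → q ≤ r → q * p ≤ r * p
  *-monoʳ-≤ {p} 0≤p = *-monoʳ-≤-nonNeg p {{nonNegative 0≤p}}

  *-cancelˡ-≤ : ∀ {p q r} → 0ℚ < p → p * q ≤ p * r → q ≤ r
  *-cancelˡ-≤ {p} 0<p = *-cancelˡ-≤-pos p {{positive 0<p}}

  ∣p∣≤ : ∀ {p q} → p ≤ q → - q ≤ p → ∣ p ∣ ≤ q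
  ∣p∣≤ {p} {q} p≤q -q≤p with ∣p∣≡p∨∣p∣≡-p p
  ... | inj₁ eq = subst (_≤ q) (sym eq) p≤q
  ... | inj₂ eq = subst (_≤ q) (sym eq)
    (subst (- p ≤_) (solve 1 (λ q → :- (:- q) := q) refl q) (neg-antimono-≤ -q≤p))

  p≤∣p∣ : ∀ p → p ≤ ∣ p ∣
  p≤∣p∣ p with ≤-total 0ℚ p
  ... | inj₁ 0≤p = ≤-reflexive (sym (0≤p⇒∣p∣≡p 0≤p))
  ... | inj₂ p≤0 = ≤-trans p≤0 (0≤∣p∣ p)

  ∣p∣≤⇒p≤ : ∀ {p q} → ∣ p ∣ ≤ q → p ≤ q
  ∣p∣≤⇒p≤ {p} = ≤-trans (p≤∣p∣ p)

  ∣p∣≤⇒-p≤ : ∀ {p q} → ∣ p ∣ ≤ q → - p ≤ q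
  ∣p∣≤⇒-p≤ {p} h = ∣p∣≤⇒p≤ (subst (_≤ _) (sym (∣-p∣≡∣p∣ p)) h)

  ∣p-q∣≤⇒p≤q+ : ∀ {p q ε} → ∣ p - q ∣ ≤ ε → p ≤ q + ε
  ∣p-q∣≤⇒p≤q+ {p} {q} {ε} h = ≤-by (ε - (p - q)) (p≤q⇒0≤q-p (∣p∣≤⇒p≤ h))
    (solve 3 (λ p q ε → p :+ (ε :- (p :- q)) := q :+ ε) refl p q ε)

  ∣p-q∣≤⇒q≤p+ : ∀ {p q ε} → ∣ p - q ∣ ≤ ε → q ≤ p + ε
  ∣p-q∣≤⇒q≤p+ {p} {q} {ε} h = ≤-by (ε - (- (p - q))) (p≤q⇒0≤q-p (∣p∣≤⇒-p≤ h))
    (solve 3 (λ p q ε → q :+ (ε :- (:- (p :- q))) := p :+ ε) refl p q ε)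

  ∣*∣-mono-≤ : ∀ {p q u v} → ∣ p ∣ ≤ u → ∣ q ∣ ≤ v → ∣ p * q ∣ ≤ u * v
  ∣*∣-mono-≤ {p} {q} {u} {v} p≤ q≤ = subst (_≤ u * v) (sym (∣p*q∣≡∣p∣*∣q∣ p q))
    (*-mono-≤ (0≤∣p∣ p) p≤ (0≤∣p∣ q) q≤)

  ∣+∣-mono-≤ : ∀ {p q u v} → ∣ p ∣ ≤ u → ∣ q ∣ ≤ v → ∣ p + q ∣ ≤ u + v
  ∣+∣-mono-≤ {p} {q} p≤ q≤ = ≤-trans (∣p+q∣≤∣p∣+∣q∣ p q) (+-mono-≤ p≤ q≤)

  0<½ : 0ℚ < ½
  0<½ = positive⁻¹ ½

  0<1 : 0ℚ < 1ℚ
  0<1 = positive⁻¹ 1ℚ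

  0≤1 : 0ℚ ≤ 1ℚ
  0≤1 = nonNegative⁻¹ 1ℚ

  half+half : ∀ p → p * ½ + p * ½ ≡ p
  half+half p = trans (sym (*-distribˡ-+ p ½ ½)) (*-identityʳ p)

  p≤p+q : ∀ {p q} → 0ℚ ≤ q → p ≤ p + q
  p≤p+q {p} {q} 0≤q = ≤-by q 0≤q refl

  p<p+q : ∀ {p q} → 0ℚ < q → p < p + q
  p<p+q {p} {q} 0<q = <-by q 0<q refl

  p≤q+ε⇒p≤q : ∀ {p q} → (∀ ε → 0ℚ < ε → p ≤ q + ε) → p ≤ q
  p≤q+ε⇒p≤q {p} {q} h with p ≤? q
  ... | yes p≤q = p≤q
  ... | no  p≰q = contradiction
        (≤-<-trans (h d (0<p*q 0<p-q 0<½)) (<-by {q + d} d (0<p*q 0<p-q 0<½) q+d+d≡p)) (<-irrefl refl)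
    where
    0<p-q = p<q⇒0<q-p (≰⇒> p≰q)
    d = (p - q) * ½
    q+d+d≡p : q + d + d ≡ p
    q+d+d≡p = trans (+-assoc q d d) (trans (cong (_+_ q) (half+half (p - q)))
      (solve 2 (λ p q → q :+ (p :- q) := p) refl p q))

  reciprocal : ∀ {p} → 0ℚ < p → ∃[ r ] 0ℚ < r × p * r ≡ 1ℚ
  reciprocal {p} 0<p = r , positive⁻¹ r {{1/pos⇒pos p {{positive 0<p}}}} , *-inverseʳ p {{nz}}
    where
    nz : NonZero p
    nz = pos⇒nonZero p {{positive 0<p}}
    r = (1/ p) {{nz}}

  toℚᵘ-fromℤ : ∀ i → toℚᵘ (fromℤ i) ℚᵘ.≃ mkℚᵘ i 0
  toℚᵘ-fromℤ i = toℚᵘ-fromℚᵘ (mkℚᵘ i 0)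

  fromℤ-+ : ∀ i j → fromℤ (i ℤ.+ j) ≡ fromℤ i + fromℤ j
  fromℤ-+ i j = toℚᵘ-injective (begin
    toℚᵘ (fromℤ (i ℤ.+ j))           ≈⟨ toℚᵘ-fromℤ (i ℤ.+ j) ⟩
    mkℚᵘ (i ℤ.+ j) 0                 ≈⟨ ℚᵘ.*≡* (cong (ℤ._* 1ℤ)
                                          (cong₂ ℤ._+_ (sym (ℤ.*-identityʳ i)) (sym (ℤ.*-identityʳ j)))) ⟩
    mkℚᵘ i 0 ℚᵘ.+ mkℚᵘ j 0           ≈⟨ ℚᵘ.+-cong (toℚᵘ-fromℤ i) (toℚᵘ-fromℤ j) ⟨
    toℚᵘ (fromℤ i) ℚᵘ.+ toℚᵘ (fromℤ j) ≈⟨ toℚᵘ-homo-+ (fromℤ i) (fromℤ j) ⟨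
    toℚᵘ (fromℤ i + fromℤ j)         ∎)
    where open import Relation.Binary.Reasoning.Setoid ℚᵘ.≃-setoid

  fromℤ-* : ∀ i j → fromℤ (i ℤ.* j) ≡ fromℤ i * fromℤ j
  fromℤ-* i j = toℚᵘ-injective (begin
    toℚᵘ (fromℤ (i ℤ.* j))           ≈⟨ toℚᵘ-fromℤ (i ℤ.* j) ⟩
    mkℚᵘ i 0 ℚᵘ.* mkℚᵘ j 0           ≈⟨ ℚᵘ.*-cong (toℚᵘ-fromℤ i) (toℚᵘ-fromℤ j) ⟨
    toℚᵘ (fromℤ i) ℚᵘ.* toℚᵘ (fromℤ j) ≈⟨ toℚᵘ-homo-* (fromℤ i) (fromℤ j) ⟨
    toℚᵘ (fromℤ i * fromℤ j)         ∎)
    where open import Relation.Binary.Reasoning.Setoid ℚᵘ.≃-setoid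

  fromℤ-neg : ∀ i → fromℤ (ℤ.- i) ≡ - fromℤ i
  fromℤ-neg i = toℚᵘ-injective (begin
    toℚᵘ (fromℤ (ℤ.- i))   ≈⟨ toℚᵘ-fromℤ (ℤ.- i) ⟩
    ℚᵘ.- (mkℚᵘ i 0)        ≈⟨ ℚᵘ.-‿cong (toℚᵘ-fromℤ i) ⟨
    ℚᵘ.- toℚᵘ (fromℤ i)    ≈⟨ toℚᵘ-homo‿- (fromℤ i) ⟨
    toℚᵘ (- fromℤ i)       ∎)
    where open import Relation.Binary.Reasoning.Setoid ℚᵘ.≃-setoid

  fromℤ-mono-≤ : ∀ {i j} → i ℤ.≤ j → fromℤ i ≤ fromℤ j
  fromℤ-mono-≤ {i} {j} i≤j = toℚᵘ-cancel-≤ (begin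
    toℚᵘ (fromℤ i) ≃⟨ toℚᵘ-fromℤ i ⟩
    mkℚᵘ i 0       ≤⟨ ℚᵘ.*≤* (ℤ.*-monoʳ-≤-nonNeg 1ℤ i≤j) ⟩
    mkℚᵘ j 0       ≃⟨ toℚᵘ-fromℤ j ⟨
    toℚᵘ (fromℤ j) ∎)
    where open ℚᵘ.≤-Reasoning

  fromℤ-cancel-≤ : ∀ {i j} → fromℤ i ≤ fromℤ j → i ℤ.≤ j
  fromℤ-cancel-≤ {i} {j} h = subst₂ ℤ._≤_ (ℤ.*-identityʳ i) (ℤ.*-identityʳ j) (ℚᵘ.drop-*≤* (begin
    mkℚᵘ i 0       ≃⟨ toℚᵘ-fromℤ i ⟨
    toℚᵘ (fromℤ i) ≤⟨ toℚᵘ-mono-≤ h ⟩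
    toℚᵘ (fromℤ j) ≃⟨ toℚᵘ-fromℤ j ⟩
    mkℚᵘ j 0       ∎))
    where open ℚᵘ.≤-Reasoning

  fromℕ-+ : ∀ m n → fromℕ (m ℕ.+ n) ≡ fromℕ m + fromℕ n
  fromℕ-+ m n = fromℤ-+ (+ m) (+ n)

  fromℕ-* : ∀ m n → fromℕ (m ℕ.* n) ≡ fromℕ m * fromℕ n
  fromℕ-* m n = trans (cong fromℤ (ℤ.pos-* m n)) (fromℤ-* (+ m) (+ n))

  fromℕ-mono-≤ : ∀ {m n} → m ℕ.≤ n → fromℕ m ≤ fromℕ n
  fromℕ-mono-≤ m≤n = fromℤ-mono-≤ (ℤ.+≤+ m≤n)

  fromℕ-cancel-≤ : ∀ {m n} → fromℕ m ≤ fromℕ n → m ℕ.≤ n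
  fromℕ-cancel-≤ h = ℤ.drop‿+≤+ (fromℤ-cancel-≤ h)

  0≤fromℕ : ∀ n → 0ℚ ≤ fromℕ n
  0≤fromℕ n = fromℕ-mono-≤ {0} {n} ℕ.z≤n

  1≤fromℕ : ∀ n .{{_ : ℕ.NonZero n}} → 1ℚ ≤ fromℕ n
  1≤fromℕ n = fromℕ-mono-≤ {1} {n} (ℕ.>-nonZero⁻¹ n)

  0<fromℕ : ∀ n .{{_ : ℕ.NonZero n}} → 0ℚ < fromℕ n
  0<fromℕ n = <-≤-trans 0<1 (1≤fromℕ n)

  ∣fromℤ∣ : ∀ i → ∣ fromℤ i ∣ ≡ fromℕ ℤ.∣ i ∣
  ∣fromℤ∣ (+ n)    = 0≤p⇒∣p∣≡p (0≤fromℕ n)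
  ∣fromℤ∣ -[1+ n ] = trans (cong ∣_∣ (fromℤ-neg (+ suc n)))
    (trans (∣-p∣≡∣p∣ (fromℕ (suc n))) (0≤p⇒∣p∣≡p (0≤fromℕ (suc n))))

  /-*-cancel : ∀ i n .{{_ : ℕ.NonZero n}} → (i / n) * fromℕ n ≡ fromℤ i
  /-*-cancel i n@(suc n-1) = toℚᵘ-injective (begin
    toℚᵘ (i / n * fromℕ n)           ≈⟨ toℚᵘ-homo-* (i / n) (fromℕ n) ⟩
    toℚᵘ (i / n) ℚᵘ.* toℚᵘ (fromℕ n) ≈⟨ ℚᵘ.*-cong (toℚᵘ-fromℚᵘ (mkℚᵘ i n-1)) (toℚᵘ-fromℤ (+ n)) ⟩
    mkℚᵘ i n-1 ℚᵘ.* mkℚᵘ (+ n) 0     ≈⟨ ℚᵘ.*≡* (trans (ℤ.*-identityʳ (i ℤ.* + n))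
                                          (cong (λ t → i ℤ.* + t) (sym (ℕ.*-identityʳ n)))) ⟩
    mkℚᵘ i 0                         ≈⟨ toℚᵘ-fromℤ i ⟨
    toℚᵘ (fromℤ i)                   ∎)
    where open import Relation.Binary.Reasoning.Setoid ℚᵘ.≃-setoid

  p*↧p≡↥p : ∀ p → p * fromℕ (↧ₙ p) ≡ fromℤ (↥ p)
  p*↧p≡↥p p@record{} = trans (cong (_* fromℕ (↧ₙ p)) (sym (↥p/↧p≡p p))) (/-*-cancel (↥ p) (↧ₙ p))

  archimedean : ∀ p → ∃[ n ] p ≤ fromℕ n
  archimedean p@record{} = ℤ.∣ ↥ p ∣ , ≤-trans (p≤∣p∣ p) (begin
    ∣ p ∣                  ≡⟨ *-identityʳ ∣ p ∣ ⟨
    ∣ p ∣ * 1ℚ             ≤⟨ *-monoˡ-≤ (0≤∣p∣ p) (1≤fromℕ (↧ₙ p)) ⟩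
    ∣ p ∣ * fromℕ (↧ₙ p)   ≡⟨ cong (∣ p ∣ *_) (0≤p⇒∣p∣≡p (0≤fromℕ (↧ₙ p))) ⟨
    ∣ p ∣ * ∣ fromℕ (↧ₙ p) ∣ ≡⟨ ∣p*q∣≡∣p∣*∣q∣ p (fromℕ (↧ₙ p)) ⟨
    ∣ p * fromℕ (↧ₙ p) ∣   ≡⟨ cong ∣_∣ (p*↧p≡↥p p) ⟩
    ∣ fromℤ (↥ p) ∣        ≡⟨ ∣fromℤ∣ (↥ p) ⟩
    fromℕ ℤ.∣ ↥ p ∣        ∎)
    where open ≤-Reasoning

  0<^ : ∀ {p} n → 0ℚ < p → 0ℚ < p ^ n
  0<^ zero    0<p = 0<1
  0<^ (suc n) 0<p = 0<p*q 0<p (0<^ n 0<p)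

  0≤^ : ∀ {p} n → 0ℚ ≤ p → 0ℚ ≤ p ^ n
  0≤^ zero    0≤p = 0≤1
  0≤^ (suc n) 0≤p = 0≤p*q 0≤p (0≤^ n 0≤p)

  1^n≡1 : ∀ n → 1ℚ ^ n ≡ 1ℚ
  1^n≡1 zero    = refl
  1^n≡1 (suc n) = trans (*-identityˡ (1ℚ ^ n)) (1^n≡1 n)

  ^-monoˡ-≤ : ∀ {p q} n → 0ℚ ≤ p → p ≤ q → p ^ n ≤ q ^ n
  ^-monoˡ-≤ zero    0≤p p≤q = ≤-refl
  ^-monoˡ-≤ (suc n) 0≤p p≤q = *-mono-≤ 0≤p p≤q (0≤^ n 0≤p) (^-monoˡ-≤ n 0≤p p≤q)

  1≤^ : ∀ {p} n → 1ℚ ≤ p → 1ℚ ≤ p ^ n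
  1≤^ {p} n 1≤p = subst (_≤ p ^ n) (1^n≡1 n) (^-monoˡ-≤ n 0≤1 1≤p)

  ^-monoʳ-≤ : ∀ {p m n} → 1ℚ ≤ p → m ℕ.≤ n → p ^ m ≤ p ^ n
  ^-monoʳ-≤ {p} {n = n} 1≤p ℕ.z≤n = 1≤^ n 1≤p
  ^-monoʳ-≤ 1≤p (ℕ.s≤s m≤n) = *-monoˡ-≤ (≤-trans 0≤1 1≤p) (^-monoʳ-≤ 1≤p m≤n)

  ^-cancelˡ-≤ : ∀ {p q} n .{{_ : ℕ.NonZero n}} → 0ℚ ≤ q → p ^ n ≤ q ^ n → p ≤ q
  ^-cancelˡ-≤ {p} {q} (suc n) 0≤q p^n≤q^n with p ≤? q
  ... | yes p≤q = p≤q
  ... | no  p≰q = contradiction (<-≤-trans q^<p^ p^n≤q^n) (<-irrefl refl)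
    where
    q<p = ≰⇒> p≰q
    q^<p^ : q ^ suc n < p ^ suc n
    q^<p^ = ≤-<-trans (*-monoˡ-≤ 0≤q (^-monoˡ-≤ n 0≤q (<⇒≤ q<p)))
      (*-monoˡ-<-pos (p ^ n) {{positive (0<^ n (≤-<-trans 0≤q q<p))}} q<p)

  ∣^∣ : ∀ p n → ∣ p ^ n ∣ ≡ ∣ p ∣ ^ n
  ∣^∣ p zero    = refl
  ∣^∣ p (suc n) = trans (∣p*q∣≡∣p∣*∣q∣ p (p ^ n)) (cong (∣ p ∣ *_) (∣^∣ p n))

  bernoulli : ∀ {p} n → 0ℚ ≤ p → 1ℚ + fromℕ n * p ≤ (1ℚ + p) ^ n
  bernoulli {p} zero    0≤p = ≤-reflexive (trans (cong (_+_ 1ℚ) (*-zeroˡ p)) (+-identityʳ 1ℚ))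
  bernoulli {p} (suc n) 0≤p = begin
    1ℚ + fromℕ (suc n) * p          ≡⟨ cong (λ t → 1ℚ + t * p) (fromℕ-+ 1 n) ⟩
    1ℚ + (1ℚ + fromℕ n) * p         ≤⟨ ≤-by (fromℕ n * p * p) (0≤p*q (0≤p*q (0≤fromℕ n) 0≤p) 0≤p)
      (solve 2 (λ n p → con 1ℚ :+ (con 1ℚ :+ n) :* p :+ n :* p :* p
                          := (con 1ℚ :+ p) :* (con 1ℚ :+ n :* p)) refl (fromℕ n) p) ⟩
    (1ℚ + p) * (1ℚ + fromℕ n * p)   ≤⟨ *-monoˡ-≤ (0≤p+q 0≤1 0≤p) (bernoulli n 0≤p) ⟩
    (1ℚ + p) ^ suc n                ∎
    where open ≤-Reasoning

  ^-unbounded : ∀ {p} → 1ℚ < p → ∀ b → ∃[ n ] b ≤ p ^ n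
  ^-unbounded {p} 1<p b = n , (begin
    b                        ≡⟨ *-identityʳ b ⟨
    b * 1ℚ                   ≡⟨ cong (b *_) dr≡1 ⟨
    b * (d * r)              ≡⟨ solve 3 (λ b d r → b :* (d :* r) := b :* r :* d) refl b d r ⟩
    b * r * d                ≤⟨ *-monoʳ-≤ (<⇒≤ 0<d) br≤n ⟩
    fromℕ n * d              ≤⟨ ≤-by 1ℚ 0≤1 (+-comm (fromℕ n * d) 1ℚ) ⟩
    1ℚ + fromℕ n * d         ≤⟨ bernoulli n (<⇒≤ 0<d) ⟩
    (1ℚ + d) ^ n             ≡⟨ cong (_^ n) (solve 2 (λ o p → o :+ (p :- o) := p) refl 1ℚ p) ⟩
    p ^ n                    ∎)
    where
    open ≤-Reasoning
    d = p - 1ℚ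
    0<d = p<q⇒0<q-p 1<p
    r = proj₁ (reciprocal 0<d)
    dr≡1 = proj₂ (proj₂ (reciprocal 0<d))
    n = proj₁ (archimedean (b * r))
    br≤n = proj₂ (archimedean (b * r))

  -- A substitute for the n-th root of p, which need not be rational. In the inductive step some q
  -- with 1 < q < p receives the first n factors, and θ = (p - q) / q is the increment for which 1 +
  -- θ = p / q.
  root-above-one : ∀ {p} n → 1ℚ < p → ∃[ η ] 0ℚ < η × (1ℚ + η) ^ n ≤ p
  root-above-one {p} zero    1<p = 1ℚ , 0<1 , <⇒≤ 1<p
  root-above-one {p} (suc n) 1<p =
    let q , 1<q , q<p = <-dense 1<p
        η , 0<η , η≤ = root-above-one n 1<q
        0<q = <-trans 0<1 1<q
        r , 0<r , qr≡1 = reciprocal 0<q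
        θ = (p - q) * r
        0<θ = 0<p*q (p<q⇒0<q-p q<p) 0<r
        ζ = η ⊓ θ
        0<ζ = min-pos 0<η 0<θ
    in ζ , 0<ζ , (begin
      (1ℚ + ζ) * (1ℚ + ζ) ^ n   ≤⟨ *-mono-≤ (0≤p+q 0≤1 (<⇒≤ 0<ζ)) (+-monoʳ-≤ 1ℚ (p⊓q≤q η θ))
                                     (0≤^ n (0≤p+q 0≤1 (<⇒≤ 0<ζ)))
                                     (^-monoˡ-≤ n (0≤p+q 0≤1 (<⇒≤ 0<ζ)) (+-monoʳ-≤ 1ℚ (p⊓q≤p η θ))) ⟩
      (1ℚ + θ) * (1ℚ + η) ^ n   ≤⟨ *-monoˡ-≤ (0≤p+q 0≤1 (<⇒≤ 0<θ)) η≤ ⟩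
      (1ℚ + θ) * q              ≡⟨ solve 3 (λ p q r → (con 1ℚ :+ (p :- q) :* r) :* q
                                      := q :+ (p :- q) :* (q :* r)) refl p q r ⟩
      q + (p - q) * (q * r)     ≡⟨ cong (λ t → q + (p - q) * t) qr≡1 ⟩
      q + (p - q) * 1ℚ          ≡⟨ solve 2 (λ p q → q :+ (p :- q) :* con 1ℚ := p) refl p q ⟩
      p                         ∎)
    where
    open ≤-Reasoning
    min-pos : ∀ {p q} → 0ℚ < p → 0ℚ < q → 0ℚ < p ⊓ q
    min-pos {p} {q} 0<p 0<q with ⊓-sel p q
    ... | inj₁ eq = subst (0ℚ <_) (sym eq) 0<p
    ... | inj₂ eq = subst (0ℚ <_) (sym eq) 0<q

  -- Powers and the exponential

  -- Both sides have the exponent A B J, and L / (J B) ≤ l / (J A).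
  exp-compare : ∀ A B J {L l u v} → u * fromℕ (J ℕ.* B) ≡ 1ℚ → v * fromℕ (J ℕ.* A) ≡ 1ℚ →
    0ℚ ≤ u → 0ℚ ≤ v → 0ℚ ≤ 1ℚ + L * u → fromℕ A * L ≤ fromℕ B * l →
    ((1ℚ + L * u) ^ (J ℕ.* B)) ^ A ≤ ((1ℚ + l * v) ^ (J ℕ.* A)) ^ B
  exp-compare A B J {L} {l} {u} {v} uJB≡1 vJA≡1 0≤u 0≤v 0≤1+Lu AL≤Bl = begin
    ((1ℚ + L * u) ^ (J ℕ.* B)) ^ A   ≡⟨ ^-assocʳ (1ℚ + L * u) (J ℕ.* B) A ⟩
    (1ℚ + L * u) ^ (J ℕ.* B ℕ.* A)   ≤⟨ ^-monoˡ-≤ (J ℕ.* B ℕ.* A) 0≤1+Lu (+-monoʳ-≤ 1ℚ Lu≤lv) ⟩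
    (1ℚ + l * v) ^ (J ℕ.* B ℕ.* A)   ≡⟨ cong ((1ℚ + l * v) ^_) (trans (ℕ.*-assoc J B A)
                                          (trans (cong (J ℕ.*_) (ℕ.*-comm B A)) (sym (ℕ.*-assoc J A B)))) ⟩
    (1ℚ + l * v) ^ (J ℕ.* A ℕ.* B)   ≡⟨ ^-assocʳ (1ℚ + l * v) (J ℕ.* A) B ⟨
    ((1ℚ + l * v) ^ (J ℕ.* A)) ^ B   ∎
    where
    open ≤-Reasoning
    j = fromℕ J
    uJB = trans (cong (u *_) (sym (fromℕ-* J B))) uJB≡1
    vJA = trans (cong (v *_) (sym (fromℕ-* J A))) vJA≡1
    Lu≤lv : L * u ≤ l * v
    Lu≤lv = begin
      L * u                          ≡⟨ *-identityʳ (L * u) ⟨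
      L * u * 1ℚ                     ≡⟨ cong (L * u *_) vJA ⟨
      L * u * (v * (j * fromℕ A))    ≡⟨ solve 5 (λ L u v j A → L :* u :* (v :* (j :* A)) := u :* v :* j :* (A :* L))
                                          refl L u v j (fromℕ A) ⟩
      u * v * j * (fromℕ A * L)      ≤⟨ *-monoˡ-≤ (0≤p*q (0≤p*q 0≤u 0≤v) (0≤fromℕ J)) AL≤Bl ⟩
      u * v * j * (fromℕ B * l)      ≡⟨ solve 5 (λ l u v j B → u :* v :* j :* (B :* l) := l :* v :* (u :* (j :* B)))
                                          refl l u v j (fromℕ B) ⟩
      l * v * (u * (j * fromℕ B))    ≡⟨ cong (l * v *_) uJB ⟩
      l * v * 1ℚ                     ≡⟨ *-identityʳ (l * v) ⟩
      l * v                          ∎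

  1+p≤[1+pu]^n : ∀ {p u} n → u * fromℕ n ≡ 1ℚ → 0ℚ ≤ u → 0ℚ ≤ p → 1ℚ + p ≤ (1ℚ + p * u) ^ n
  1+p≤[1+pu]^n {p} {u} n un≡1 0≤u 0≤p = begin
    1ℚ + p                     ≡⟨ cong (_+_ 1ℚ) (trans (sym (*-identityʳ p)) (cong (p *_) (sym un≡1))) ⟩
    1ℚ + p * (u * fromℕ n)     ≡⟨ solve 3 (λ p u n → con 1ℚ :+ p :* (u :* n) := con 1ℚ :+ n :* (p :* u)) refl p u (fromℕ n) ⟩
    1ℚ + fromℕ n * (p * u)     ≤⟨ bernoulli n (0≤p*q 0≤p 0≤u) ⟩
    (1ℚ + p * u) ^ n           ∎
    where open ≤-Reasoning

  -- (1 - tu)(1 + tu) ≤ 1, and (1 + tu)ⁿ ≥ 1 + t by Bernoulli.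
  [1+pu]^n*[1+t]≤1 : ∀ {p t u} n → u * fromℕ n ≡ 1ℚ → 0ℚ ≤ u → 0ℚ ≤ t → 0ℚ ≤ 1ℚ + p * u → p + t ≤ 0ℚ →
    (1ℚ + p * u) ^ n * (1ℚ + t) ≤ 1ℚ
  [1+pu]^n*[1+t]≤1 {p} {t} {u} n un≡1 0≤u 0≤t 0≤1+pu p+t≤0 = begin
    (1ℚ + p * u) ^ n * (1ℚ + t)              ≤⟨ *-monoˡ-≤ (0≤^ n 0≤1+pu) (1+p≤[1+pu]^n n un≡1 0≤u 0≤t) ⟩
    (1ℚ + p * u) ^ n * (1ℚ + t * u) ^ n      ≡⟨ ^-distrib-* (1ℚ + p * u) (1ℚ + t * u) n ⟨
    ((1ℚ + p * u) * (1ℚ + t * u)) ^ n        ≤⟨ ^-monoˡ-≤ n (0≤p*q 0≤1+pu 0≤1+tu) prod≤1 ⟩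
    1ℚ ^ n                                   ≡⟨ 1^n≡1 n ⟩
    1ℚ                                       ∎
    where
    open ≤-Reasoning
    0≤1+tu = 0≤p+q 0≤1 (0≤p*q 0≤t 0≤u)
    prod≤1 : (1ℚ + p * u) * (1ℚ + t * u) ≤ 1ℚ
    prod≤1 = ≤-by ((0ℚ - (p + t)) * u * (1ℚ + t * u) + t * u * (t * u))
      (0≤p+q (0≤p*q (0≤p*q (p≤q⇒0≤q-p p+t≤0) 0≤u) 0≤1+tu) (0≤p*q (0≤p*q 0≤t 0≤u) (0≤p*q 0≤t 0≤u)))
      (solve 3 (λ p t u → (con 1ℚ :+ p :* u) :* (con 1ℚ :+ t :* u) :+ ((con 0ℚ :- (p :+ t)) :* u :* (con 1ℚ :+ t :* u) :+ t :* u :* (t :* u))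
        := con 1ℚ) refl p t u)

  -- The order of quantifiers matters: η is fixed before P and p, so it can determine how closely
  -- these must approximate their limits. The additional exponent in `suc B` pays for the room η on
  -- both sides.
  Separates : ℕ → ℕ → ℚ → ℚ → Set
  Separates A B t η = ∀ P p → 0ℚ ≤ P → P ^ A ≤ p ^ B → 1ℚ + t ≤ p →
    ∃[ M ] ∃[ m ] 1ℚ ≤ M × 1ℚ < m × M ^ A ≤ m ^ suc B × P + η ≤ M × m + η ≤ p

  -- M and m arise from P ⊔ 1 and p through multiplication and division by
  -- 1 + η, where (1 + η)^(A + B + 1) ≤ 1 + t ≤ p.
  separate : ∀ A B {t} .{{_ : ℕ.NonZero A}} → 0ℚ < t → ∃[ η ] 0ℚ < η × Separates A B t η
  separate A B {t} 0<t =
    let η , 0<η , η-root = root-above-one (suc (A ℕ.+ B)) (p<p+q {1ℚ} 0<t)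
        h = 1ℚ + η
        0≤η = <⇒≤ 0<η
        1≤h = p≤p+q {1ℚ} 0≤η
        0<h = <-≤-trans 0<1 1≤h
        ζ , 0<ζ , hζ≡1 = reciprocal 0<h
    in η , 0<η , λ P p 0≤P P^A≤p^B 1+t≤p →
      let m = p * ζ
          -- The maximum secures M ≥ 1, which `growth` requires; the inequality with pᴮ survives
          -- because p ≥ 1.
          P₁ = P ⊔ 1ℚ
          0≤P₁ = ≤-trans 0≤1 (p≤q⊔p P 1ℚ)
          1≤p = ≤-trans (p≤p+q {1ℚ} (<⇒≤ 0<t)) 1+t≤p
          h*m≡p : h * m ≡ p
          h*m≡p = trans (solve 3 (λ h p ζ → h :* (p :* ζ) := p :* (h :* ζ)) refl h p ζ)
            (trans (cong (p *_) hζ≡1) (*-identityʳ p))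
          h^≤m : h ^ (A ℕ.+ B) ≤ m
          h^≤m = *-cancelˡ-≤ 0<h (≤-trans η-root (≤-trans 1+t≤p (≤-reflexive (sym h*m≡p))))
          h≤m : h ≤ m
          h≤m = ≤-trans (subst (_≤ h ^ (A ℕ.+ B)) (*-identityʳ h)
            (^-monoʳ-≤ {m = 1} 1≤h (ℕ.≤-trans (ℕ.>-nonZero⁻¹ A) (ℕ.m≤m+n A B)))) h^≤m
          0≤m = ≤-trans (<⇒≤ 0<h) h≤m
          P₁^A≤p^B : P₁ ^ A ≤ p ^ B
          P₁^A≤p^B = max-≤ P A P^A≤p^B (subst (_≤ p ^ B) (sym (1^n≡1 A)) (1≤^ B 1≤p))
      in P₁ * h , m
       , subst (_≤ P₁ * h) (*-identityʳ 1ℚ) (*-mono-≤ 0≤1 (p≤q⊔p P 1ℚ) 0≤1 1≤h)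
       , <-≤-trans (p<p+q {1ℚ} 0<η) h≤m
       , (begin
          (P₁ * h) ^ A              ≡⟨ ^-distrib-* P₁ h A ⟩
          P₁ ^ A * h ^ A            ≤⟨ *-monoʳ-≤ (0≤^ A (<⇒≤ 0<h)) P₁^A≤p^B ⟩
          p ^ B * h ^ A             ≡⟨ cong (λ t → t ^ B * h ^ A) h*m≡p ⟨
          (h * m) ^ B * h ^ A       ≡⟨ cong (_* h ^ A) (^-distrib-* h m B) ⟩
          h ^ B * m ^ B * h ^ A     ≡⟨ solve 3 (λ x y z → x :* y :* z := z :* x :* y) refl (h ^ B) (m ^ B) (h ^ A) ⟩
          h ^ A * h ^ B * m ^ B     ≡⟨ cong (_* m ^ B) (^-homo-* h A B) ⟨
          h ^ (A ℕ.+ B) * m ^ B     ≤⟨ *-monoʳ-≤ (0≤^ B 0≤m) h^≤m ⟩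
          m * m ^ B                 ∎)
       , (begin
          P + η                     ≤⟨ +-monoˡ-≤ η (p≤p⊔q P 1ℚ) ⟩
          P₁ + η                    ≡⟨ cong (_+_ P₁) (*-identityˡ η) ⟨
          P₁ + 1ℚ * η               ≤⟨ +-monoʳ-≤ P₁ (*-monoʳ-≤ 0≤η (p≤q⊔p P 1ℚ)) ⟩
          P₁ + P₁ * η               ≡⟨ solve 2 (λ P η → P :+ P :* η := P :* (con 1ℚ :+ η)) refl P₁ η ⟩
          P₁ * h                    ∎)
       , (begin
          m + η                     ≡⟨ cong (_+_ m) (*-identityˡ η) ⟨
          m + 1ℚ * η                ≤⟨ +-monoʳ-≤ m (*-monoʳ-≤ 0≤η (≤-trans 1≤h h≤m)) ⟩
          m + m * η                 ≡⟨ solve 2 (λ m η → m :+ m :* η := (con 1ℚ :+ η) :* m) refl m η ⟩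
          h * m                     ≡⟨ h*m≡p ⟩
          p                         ∎)
    where
    open ≤-Reasoning
    max-≤ : ∀ P n {r} → P ^ n ≤ r → 1ℚ ^ n ≤ r → (P ⊔ 1ℚ) ^ n ≤ r
    max-≤ P n h₁ h₂ with ⊔-sel P 1ℚ
    ... | inj₁ eq = subst (λ t → t ^ n ≤ _) (sym eq) h₁
    ... | inj₂ eq = subst (λ t → t ^ n ≤ _) (sym eq) h₂

  -- Convergents

  infixr 5 _and_

  _and_ : ∀ {P Q} → Eventually P → Eventually Q → Eventually λ n → P n × Q n
  (M , p) and (N , q) = M ℕ.⊔ N , λ n n≥ →
    p n (ℕ.m⊔n≤o⇒m≤o M N n≥) , q n (ℕ.m⊔n≤o⇒n≤o M N n≥)

  eventually-map : ∀ {P Q : ℕ → Set} → (∀ n → P n → Q n) → Eventually P → Eventually Q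
  eventually-map f (N , p) = N , λ n n≥ → f n (p n n≥)

  witness : ∀ {P : ℕ → Set} → Eventually P → ∃ P
  witness (N , p) = N , p N ℕ.≤-refl

  eventually-const : ∀ {P : Set} → Eventually (λ _ → P) → P
  eventually-const ev = proj₂ (witness ev)

  p+δ≤q⇒p≤q : ∀ {p q δ} → 0ℚ < δ → p + δ ≤ q → p ≤ q
  p+δ≤q⇒p≤q 0<δ = ≤-trans (p≤p+q (<⇒≤ 0<δ))

  converges⇒close : ∀ s x → Converges s x → ∀ ε → 0ℚ < ε →
    Eventually λ n → Eventually λ k → ∣ seq (s n) k - seq x k ∣ ≤ ε
  converges⇒close s x h ε 0<ε = eventually-map
    (λ n (δ , 0<δ , ev) → eventually-map (λ k → p+δ≤q⇒p≤q 0<δ) ev) (h ε 0<ε)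

  module Approximation (a : ℕ → ℕ) (a>0 : PositiveQuotients a) where

    p q : ℕ → ℚ
    p n = fromℕ (num a n)
    q n = fromℕ (den a n)

    1≤q : ∀ n → 1ℚ ≤ q n
    1≤q n = 1≤fromℕ (den a n) {{den-nonZero a a>0 n}}

    0<q : ∀ n → 0ℚ < q n
    0<q n = <-≤-trans 0<1 (1≤q n)

    fromℕ-*+ : ∀ l m n → fromℕ (l ℕ.* m ℕ.+ n) ≡ fromℕ l * fromℕ m + fromℕ n
    fromℕ-*+ l m n = trans (fromℕ-+ (l ℕ.* m) n) (cong (_+ fromℕ n) (fromℕ-* l m))

    p-suc-suc : ∀ n → p (2 ℕ.+ n) ≡ fromℕ (a (2 ℕ.+ n)) * p (suc n) + p n
    p-suc-suc n = fromℕ-*+ (a (2 ℕ.+ n)) (num a (suc n)) (num a n)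

    q-suc-suc : ∀ n → q (2 ℕ.+ n) ≡ fromℕ (a (2 ℕ.+ n)) * q (suc n) + q n
    q-suc-suc n = fromℕ-*+ (a (2 ℕ.+ n)) (den a (suc n)) (den a n)

    -- The determinant of two convergents. As a function of the first index it satisfies the same
    -- recurrence as `p` and `q`.
    cross : ℕ → ℕ → ℚ
    cross m n = p m * q n - q m * p n

    cross-suc-suc : ∀ m n → cross (2 ℕ.+ m) n ≡ fromℕ (a (2 ℕ.+ m)) * cross (suc m) n + cross m n
    cross-suc-suc m n = trans (cong₂ (λ x y → x * q n - y * p n) (p-suc-suc m) (q-suc-suc m))
      (solve 7 (λ a p₁ p₀ q₁ q₀ q p →
          (a :* p₁ :+ p₀) :* q :- (a :* q₁ :+ q₀) :* p
            := a :* (p₁ :* q :- q₁ :* p) :+ (p₀ :* q :- q₀ :* p))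
        refl (fromℕ (a (2 ℕ.+ m))) (p (suc m)) (p m) (q (suc m)) (q m) (q n) (p n))

    cross-self : ∀ n → cross n n ≡ 0ℚ
    cross-self n = solve 2 (λ p q → p :* q :- q :* p := con 0ℚ) refl (p n) (q n)

    cross-swap : ∀ m n → cross m n ≡ - cross n m
    cross-swap m n = solve 4 (λ p q p′ q′ → p :* q′ :- q :* p′ := :- (p′ :* q :- q′ :* p))
      refl (p m) (q m) (p n) (q n)

    ∣cross-suc∣≡1 : ∀ n → ∣ cross (suc n) n ∣ ≡ 1ℚ
    ∣cross-suc∣≡1 zero    = cong ∣_∣ (solve 1 (λ q → con 1ℚ :* con 1ℚ :- q :* con 0ℚ := con 1ℚ) refl (q 1))
    ∣cross-suc∣≡1 (suc n) = begin
      ∣ cross (2 ℕ.+ n) (suc n) ∣                          ≡⟨ cong ∣_∣ (cross-suc-suc n (suc n)) ⟩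
      ∣ c * cross (suc n) (suc n) + cross n (suc n) ∣      ≡⟨ cong₂ (λ x y → ∣ c * x + y ∣) (cross-self (suc n)) (cross-swap n (suc n)) ⟩
      ∣ c * 0ℚ + - cross (suc n) n ∣                       ≡⟨ cong ∣_∣ (solve 2 (λ c d → c :* con 0ℚ :+ :- d := :- d) refl c (cross (suc n) n)) ⟩
      ∣ - cross (suc n) n ∣                                ≡⟨ ∣-p∣≡∣p∣ (cross (suc n) n) ⟩
      ∣ cross (suc n) n ∣                                  ≡⟨ ∣cross-suc∣≡1 n ⟩
      1ℚ                                                   ∎
      where
      open ≡-Reasoning
      c = fromℕ (a (2 ℕ.+ n))

    -- Two-step induction along the recurrence, from the initial values 0 and 1 of |cross|. With j =
    -- i + n, division by q_j q_{n+1} gives |q_n p_j / q_j - p_n| ≤ 1 / q_{n+1}, so the alternation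
    -- of the convergents around their limit never has to be discussed.
    ∣cross∣*q≤q : ∀ i n → ∣ cross (i ℕ.+ n) n ∣ * q (suc n) ≤ q (i ℕ.+ n)
    ∣cross∣*q≤q 0 n = subst (λ t → ∣ t ∣ * q (suc n) ≤ q n) (sym (cross-self n))
      (subst (_≤ q n) (sym (*-zeroˡ (q (suc n)))) (<⇒≤ (0<q n)))
    ∣cross∣*q≤q 1 n = ≤-reflexive (trans (cong (_* q (suc n)) (∣cross-suc∣≡1 n)) (*-identityˡ (q (suc n))))
    ∣cross∣*q≤q (suc (suc i)) n = begin
      ∣ cross (2 ℕ.+ m) n ∣ * Q                     ≡⟨ cong (λ t → ∣ t ∣ * Q) (cross-suc-suc m n) ⟩
      ∣ c * cross (suc m) n + cross m n ∣ * Q       ≤⟨ *-monoʳ-≤ (<⇒≤ (0<q (suc n))) (∣+∣-mono-≤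
                                                         (≤-reflexive (trans (∣p*q∣≡∣p∣*∣q∣ c _)
                                                           (cong (_* ∣ cross (suc m) n ∣) (0≤p⇒∣p∣≡p (0≤fromℕ (a (2 ℕ.+ m)))))))
                                                         ≤-refl) ⟩
      (c * ∣ cross (suc m) n ∣ + ∣ cross m n ∣) * Q ≡⟨ solve 4 (λ c x y Q → (c :* x :+ y) :* Q := c :* (x :* Q) :+ y :* Q)
                                                         refl c ∣ cross (suc m) n ∣ ∣ cross m n ∣ Q ⟩
      c * (∣ cross (suc m) n ∣ * Q) + ∣ cross m n ∣ * Q
                                                    ≤⟨ +-mono-≤ (*-monoˡ-≤ (0≤fromℕ (a (2 ℕ.+ m))) (∣cross∣*q≤q (suc i) n)) (∣cross∣*q≤q i n) ⟩
      c * q (suc m) + q m                           ≡⟨ q-suc-suc m ⟨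
      q (2 ℕ.+ m)                                   ∎
      where
      open ≤-Reasoning
      m = i ℕ.+ n
      c = fromℕ (a (2 ℕ.+ m))
      Q = q (suc n)

    convergent-* : ∀ n → convergent a a>0 n * q n ≡ p n
    convergent-* n = /-*-cancel (+ num a n) (den a n) {{den-nonZero a a>0 n}}

    convergent-close : ∀ {n j} → n ℕ.≤ j → ∣ q n * convergent a a>0 j - p n ∣ * q (suc n) ≤ 1ℚ
    convergent-close {n} {j} n≤j = *-cancelˡ-≤ (0<q j) (begin
      q j * (∣ q n * c - p n ∣ * Q)       ≡⟨ *-assoc (q j) ∣ q n * c - p n ∣ Q ⟨
      q j * ∣ q n * c - p n ∣ * Q         ≡⟨ cong (λ t → t * ∣ q n * c - p n ∣ * Q) (0≤p⇒∣p∣≡p (<⇒≤ (0<q j))) ⟨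
      ∣ q j ∣ * ∣ q n * c - p n ∣ * Q     ≡⟨ cong (_* Q) (∣p*q∣≡∣p∣*∣q∣ (q j) (q n * c - p n)) ⟨
      ∣ q j * (q n * c - p n) ∣ * Q       ≡⟨ cong (λ t → ∣ t ∣ * Q) (trans
                                               (solve 4 (λ qⱼ qₙ c pₙ → qⱼ :* (qₙ :* c :- pₙ) := (c :* qⱼ) :* qₙ :- qⱼ :* pₙ)
                                                 refl (q j) (q n) c (p n))
                                               (cong (λ t → t * q n - q j * p n) (convergent-* j))) ⟩
      ∣ cross j n ∣ * Q                   ≡⟨ cong (λ t → ∣ cross t n ∣ * Q) (ℕ.m∸n+n≡m n≤j) ⟨
      ∣ cross (j ℕ.∸ n ℕ.+ n) n ∣ * Q     ≤⟨ ∣cross∣*q≤q (j ℕ.∸ n) n ⟩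
      q (j ℕ.∸ n ℕ.+ n)                   ≡⟨ cong q (ℕ.m∸n+n≡m n≤j) ⟩
      q j                                 ≡⟨ *-identityʳ (q j) ⟨
      q j * 1ℚ                            ∎)
      where
      open ≤-Reasoning
      c = convergent a a>0 j
      Q = q (suc n)

    -- One unit comes from a late convergent, the other from its distance to α, which is taken at
    -- most 1 / (q_n q_{n+1}).
    limit-close : ∀ {α} → Converges (λ n → ι (convergent a a>0 n)) α →
      ∀ n → Eventually λ k → ∣ q n * seq α k - p n ∣ * q (suc n) ≤ fromℕ 2
    limit-close {α} h n =
      let ε , 0<ε , qQε≡1 = reciprocal (0<p*q (0<q n) (0<q (suc n)))
          J , ev = converges⇒close (λ m → ι (convergent a a>0 m)) α h ε 0<ε
          j = J ℕ.⊔ n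
      in eventually-map (λ k → estimate ε qQε≡1 (convergent a a>0 j) (seq α k)
           (convergent-close (ℕ.m≤n⊔m J n))) (ev j (ℕ.m≤m⊔n J n))
      where
      open ≤-Reasoning
      Q = q (suc n)
      0≤q = <⇒≤ (0<q n)
      estimate : ∀ ε → q n * Q * ε ≡ 1ℚ → ∀ c x → ∣ q n * c - p n ∣ * Q ≤ 1ℚ → ∣ c - x ∣ ≤ ε →
        ∣ q n * x - p n ∣ * Q ≤ fromℕ 2
      estimate ε qQε≡1 c x h₁ h₂ = begin
        ∣ q n * x - p n ∣ * Q
          ≡⟨ cong (λ t → ∣ t ∣ * Q) (solve 4 (λ q c x p → q :* x :- p := (q :* c :- p) :+ q :* (:- (c :- x)))
               refl (q n) c x (p n)) ⟩
        ∣ (q n * c - p n) + q n * - (c - x) ∣ * Q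
          ≤⟨ *-monoʳ-≤ (<⇒≤ (0<q (suc n))) (∣+∣-mono-≤ {q n * c - p n} ≤-refl (∣*∣-mono-≤
               (≤-reflexive (0≤p⇒∣p∣≡p 0≤q)) (subst (_≤ ε) (sym (∣-p∣≡∣p∣ (c - x))) h₂))) ⟩
        (∣ q n * c - p n ∣ + q n * ε) * Q
          ≡⟨ solve 4 (λ t q ε Q → (t :+ q :* ε) :* Q := t :* Q :+ q :* Q :* ε) refl ∣ q n * c - p n ∣ (q n) ε Q ⟩
        ∣ q n * c - p n ∣ * Q + q n * Q * ε
          ≤⟨ +-mono-≤ h₁ (≤-reflexive qQε≡1) ⟩
        1ℚ + 1ℚ ∎

  -- Growth of denominators and the auxiliary integer X

  -- Both sides are raised to the power E = e f c to keep exponents natural. Then q_r³ contributes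
  -- at most a constant times M^(3 f c · r e) ≤ m^(B r e), while q_N contributes at least m^(N E),
  -- which by `exponent-≤` is larger by a factor mˢ.
  growth : ∀ (q : ℕ → ℚ) → (∀ n → 1ℚ ≤ q n) → (∀ {m n} → m ℕ.≤ n → q m ≤ q n) →
    ∀ e f c B .{{_ : ℕ.NonZero e}} .{{_ : ℕ.NonZero f}} .{{_ : ℕ.NonZero c}} →
    suc B ≡ (2 ℕ.* e ℕ.+ f) ℕ.* c →
    ∀ {M m} → 1ℚ ≤ M → 1ℚ < m → M ^ (3 ℕ.* f ℕ.* c) ≤ m ^ B →
    Eventually (λ n → q n ≤ M ^ n) → Eventually (λ n → m ^ n ≤ q n) →
    ∀ K → 0ℚ ≤ K → Eventually λ s → ∀ r → e ℕ.* r ℕ.≤ f ℕ.* s →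
      K * q r ^ 3 ≤ q (r ℕ.+ (s ℕ.+ s))
  growth q 1≤q q-mono e f c B B≡ {M} {m} 1≤M 1<m M^≤m^ (N₁ , q≤) (N₂ , ≤q) K 0≤K =
    S ℕ.⊔ N₂ , λ s s≥ r er≤fs →
      let N = r ℕ.+ (s ℕ.+ s)
          N₂≤N = ℕ.≤-trans (ℕ.m⊔n≤o⇒n≤o S N₂ s≥) (ℕ.≤-trans (ℕ.m≤m+n s s) (ℕ.m≤n+m (s ℕ.+ s) r))
          0≤M^r = 0≤^ r (≤-trans 0≤1 1≤M)
      in ^-cancelˡ-≤ E {{ℕ.m*n≢0 (e ℕ.* f) c {{ℕ.m*n≢0 e f}}}} (≤-trans 0≤1 (1≤q N)) (begin
        (K * q r ^ 3) ^ E                        ≤⟨ ^-monoˡ-≤ E (0≤p*q 0≤K (0≤^ 3 (≤-trans 0≤1 (1≤q r))))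
                                                      (*-monoˡ-≤ 0≤K (^-monoˡ-≤ 3 (≤-trans 0≤1 (1≤q r)) (q≤CM^ r))) ⟩
        (K * (C * M ^ r) ^ 3) ^ E                ≡⟨ cong (λ t → (K * t) ^ E) (^-distrib-* C (M ^ r) 3) ⟩
        (K * (C ^ 3 * (M ^ r) ^ 3)) ^ E          ≡⟨ cong (_^ E) (*-assoc K (C ^ 3) ((M ^ r) ^ 3)) ⟨
        (D * (M ^ r) ^ 3) ^ E                    ≡⟨ ^-distrib-* D ((M ^ r) ^ 3) E ⟩
        D ^ E * ((M ^ r) ^ 3) ^ E                ≡⟨ cong (D ^ E *_) (begin-equality
          ((M ^ r) ^ 3) ^ E                        ≡⟨ cong (_^ E) (^-assocʳ M r 3) ⟩
          (M ^ (r ℕ.* 3)) ^ E                      ≡⟨ ^-assocʳ M (r ℕ.* 3) E ⟩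
          M ^ (r ℕ.* 3 ℕ.* E)                      ≡⟨ cong (M ^_) (cube-exponent r e f c) ⟩
          M ^ (A ℕ.* (r ℕ.* e))                    ≡⟨ ^-assocʳ M A (r ℕ.* e) ⟨
          (M ^ A) ^ (r ℕ.* e)                      ∎) ⟩
        D ^ E * (M ^ A) ^ (r ℕ.* e)              ≤⟨ *-mono-≤ (0≤^ E 0≤D)
                                                      (≤-trans D^E≤m^S (^-monoʳ-≤ 1≤m (ℕ.m⊔n≤o⇒m≤o S N₂ s≥)))
                                                      (0≤^ (r ℕ.* e) (0≤^ A (≤-trans 0≤1 1≤M)))
                                                      (^-monoˡ-≤ (r ℕ.* e) (0≤^ A (≤-trans 0≤1 1≤M)) M^≤m^) ⟩
        m ^ s * (m ^ B) ^ (r ℕ.* e)              ≡⟨ cong (m ^ s *_) (trans (^-assocʳ m B (r ℕ.* e))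
                                                      (cong (m ^_) (sym (ℕ.*-assoc B r e)))) ⟩
        m ^ s * m ^ (B ℕ.* r ℕ.* e)              ≡⟨ *-comm (m ^ s) (m ^ (B ℕ.* r ℕ.* e)) ⟩
        m ^ (B ℕ.* r ℕ.* e) * m ^ s              ≡⟨ ^-homo-* m (B ℕ.* r ℕ.* e) s ⟨
        m ^ (B ℕ.* r ℕ.* e ℕ.+ s)                ≤⟨ ^-monoʳ-≤ 1≤m (exponent-≤ e f c B r s B≡ er≤fs) ⟩
        m ^ (N ℕ.* E)                            ≡⟨ ^-assocʳ m N E ⟨
        (m ^ N) ^ E                              ≤⟨ ^-monoˡ-≤ E (0≤^ N (≤-trans 0≤1 1≤m)) (≤q N N₂≤N) ⟩
        q N ^ E                                  ∎)
    where
    open ≤-Reasoning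
    1≤m = <⇒≤ 1<m
    A = 3 ℕ.* f ℕ.* c
    E = e ℕ.* f ℕ.* c
    -- Nothing bounds r from below, since V may stay short. This constant makes the bound by Mʳ,
    -- known only from N₁ on, valid for every r.
    C = q N₁
    D = K * C ^ 3
    0≤C = ≤-trans 0≤1 (1≤q N₁)
    0≤D = 0≤p*q 0≤K (0≤^ 3 0≤C)
    S = proj₁ (^-unbounded 1<m (D ^ E))
    D^E≤m^S = proj₂ (^-unbounded 1<m (D ^ E))
    q≤CM^ : ∀ r → q r ≤ C * M ^ r
    q≤CM^ r with ℕ.≤-total N₁ r
    ... | inj₁ N₁≤r = ≤-trans (q≤ r N₁≤r) (subst (_≤ C * M ^ r) (*-identityˡ (M ^ r))
            (*-monoʳ-≤ (0≤^ r (≤-trans 0≤1 1≤M)) (1≤q N₁)))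
    ... | inj₂ r≤N₁ = ≤-trans (q-mono r≤N₁) (subst (_≤ C * M ^ r) (*-identityʳ C)
            (*-monoˡ-≤ 0≤C (1≤^ r 1≤M)))

  -- The distance to the nearest integer is even, so a negative X may be replaced by |X| while the
  -- nearby integer changes sign. This is needed because the infimum runs over positive naturals.
  distℚ-∣∣ : ∀ X i x → distℚ (fromℕ ℤ.∣ X ∣ * x) ≤ ∣ fromℤ X * x - fromℤ i ∣
  distℚ-∣∣ (+ n)    i x = distℚ-nearest (fromℕ n * x) i
  distℚ-∣∣ -[1+ n ] i x = ≤-trans (distℚ-nearest (fromℕ (suc n) * x) (ℤ.- i)) (≤-reflexive (begin
    ∣ fromℕ (suc n) * x - fromℤ (ℤ.- i) ∣   ≡⟨ cong (λ t → ∣ fromℕ (suc n) * x - t ∣) (fromℤ-neg i) ⟩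
    ∣ fromℕ (suc n) * x - (- fromℤ i) ∣     ≡⟨ cong ∣_∣ (solve 3 (λ n x i → n :* x :- (:- i) := :- ((:- n) :* x :- i))
                                                 refl (fromℕ (suc n)) x (fromℤ i)) ⟩
    ∣ - (- fromℕ (suc n) * x - fromℤ i) ∣   ≡⟨ ∣-p∣≡∣p∣ (- fromℕ (suc n) * x - fromℤ i) ⟩
    ∣ - fromℕ (suc n) * x - fromℤ i ∣       ≡⟨ cong (λ t → ∣ t * x - fromℤ i ∣) (fromℤ-neg (+ suc n)) ⟨
    ∣ fromℤ -[1+ n ] * x - fromℤ i ∣        ∎))
    where open ≡-Reasoning

  fromℤ-combination : ∀ i j k l → fromℤ (i ℤ.* j ℤ.+ k ℤ.* l) ≡ fromℤ i * fromℤ j + fromℤ k * fromℤ l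
  fromℤ-combination i j k l = trans (fromℤ-+ (i ℤ.* j) (k ℤ.* l)) (cong₂ _+_ (fromℤ-* i j) (fromℤ-* k l))

  -- X x ≈ c R + d P and X (a x + b) / (c x + d) ≈ a P + b Q, where X = c P + d Q.
  module Witness (a b c d P Q R : ℤ) where

    X : ℤ
    X = c ℤ.* P ℤ.+ d ℤ.* Q

    private
      a′ = fromℤ a
      b′ = fromℤ b
      c′ = fromℤ c
      d′ = fromℤ d
      P′ = fromℤ P
      Q′ = fromℤ Q
      R′ = fromℤ R

    X′≡ : fromℤ X ≡ c′ * P′ + d′ * Q′
    X′≡ = fromℤ-combination c P d Q

    S : ℚ
    S = ∣ c′ ∣ + ∣ d′ ∣

    ∣X∣≤ : 0ℚ ≤ P′ → P′ ≤ Q′ → fromℕ ℤ.∣ X ∣ ≤ S * Q′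
    ∣X∣≤ 0≤P P≤Q = begin
      fromℕ ℤ.∣ X ∣                   ≡⟨ ∣fromℤ∣ X ⟨
      ∣ fromℤ X ∣                     ≡⟨ cong ∣_∣ X′≡ ⟩
      ∣ c′ * P′ + d′ * Q′ ∣           ≤⟨ ∣+∣-mono-≤ (∣*∣-mono-≤ {c′} ≤-refl (≤-trans (≤-reflexive (0≤p⇒∣p∣≡p 0≤P)) P≤Q))
                                                    (∣*∣-mono-≤ {d′} ≤-refl (≤-reflexive (0≤p⇒∣p∣≡p (≤-trans 0≤P P≤Q)))) ⟩
      ∣ c′ ∣ * Q′ + ∣ d′ ∣ * Q′       ≡⟨ *-distribʳ-+ Q′ ∣ c′ ∣ ∣ d′ ∣ ⟨
      S * Q′                          ∎
      where open ≤-Reasoning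

    module _ {x τ} (Qx≈P : ∣ Q′ * x - P′ ∣ ≤ τ) where

      dist-x : ∣ P′ * x - R′ ∣ ≤ τ → distℚ (fromℕ ℤ.∣ X ∣ * x) ≤ S * τ
      dist-x Px≈R = begin
        distℚ (fromℕ ℤ.∣ X ∣ * x)                     ≤⟨ distℚ-∣∣ X (c ℤ.* R ℤ.+ d ℤ.* P) x ⟩
        ∣ fromℤ X * x - fromℤ (c ℤ.* R ℤ.+ d ℤ.* P) ∣ ≡⟨ cong₂ (λ s t → ∣ s * x - t ∣) X′≡ (fromℤ-combination c R d P) ⟩
        ∣ (c′ * P′ + d′ * Q′) * x - (c′ * R′ + d′ * P′) ∣
          ≡⟨ cong ∣_∣ (solve 6 (λ c d P Q R x → (c :* P :+ d :* Q) :* x :- (c :* R :+ d :* P)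
               := c :* (P :* x :- R) :+ d :* (Q :* x :- P)) refl c′ d′ P′ Q′ R′ x) ⟩
        ∣ c′ * (P′ * x - R′) + d′ * (Q′ * x - P′) ∣   ≤⟨ ∣+∣-mono-≤ (∣*∣-mono-≤ {c′} ≤-refl Px≈R) (∣*∣-mono-≤ {d′} ≤-refl Qx≈P) ⟩
        ∣ c′ ∣ * τ + ∣ d′ ∣ * τ                       ≡⟨ *-distribʳ-+ τ ∣ c′ ∣ ∣ d′ ∣ ⟨
        S * τ                                         ∎
        where open ≤-Reasoning

      -- At a fixed index the equation y (c x + d) = a x + b holds only approximately. Its defect,
      -- scaled by Q, stays as a separate summand and is the origin of the 1 in the constant.
      dist-y : ∀ {y Y} → ∣ y ∣ ≤ Y → ∣ Q′ * (y * (c′ * x + d′) - (a′ * x + b′)) ∣ ≤ τ →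
        distℚ (fromℕ ℤ.∣ X ∣ * y) ≤ (∣ a′ ∣ + 1ℚ + ∣ c′ ∣ * Y) * τ
      dist-y {y} {Y} y≤Y y≈ = begin
        distℚ (fromℕ ℤ.∣ X ∣ * y)                     ≤⟨ distℚ-∣∣ X (a ℤ.* P ℤ.+ b ℤ.* Q) y ⟩
        ∣ fromℤ X * y - fromℤ (a ℤ.* P ℤ.+ b ℤ.* Q) ∣ ≡⟨ cong₂ (λ s t → ∣ s * y - t ∣) X′≡ (fromℤ-combination a P b Q) ⟩
        ∣ (c′ * P′ + d′ * Q′) * y - (a′ * P′ + b′ * Q′) ∣
          ≡⟨ cong ∣_∣ (solve 8 (λ a b c d P Q x y → (c :* P :+ d :* Q) :* y :- (a :* P :+ b :* Q)
               := a :* (Q :* x :- P) :+ Q :* (y :* (c :* x :+ d) :- (a :* x :+ b)) :+ c :* y :* (:- (Q :* x :- P)))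
               refl a′ b′ c′ d′ P′ Q′ x y) ⟩
        ∣ a′ * (Q′ * x - P′) + Q′ * (y * (c′ * x + d′) - (a′ * x + b′)) + c′ * y * - (Q′ * x - P′) ∣
          ≤⟨ ∣+∣-mono-≤ (∣+∣-mono-≤ (∣*∣-mono-≤ {a′} ≤-refl Qx≈P) y≈)
               (∣*∣-mono-≤ (∣*∣-mono-≤ {c′} ≤-refl y≤Y) (subst (_≤ τ) (sym (∣-p∣≡∣p∣ (Q′ * x - P′))) Qx≈P)) ⟩
        ∣ a′ ∣ * τ + τ + ∣ c′ ∣ * Y * τ
          ≡⟨ solve 3 (λ a t c → a :* t :+ t :+ c :* t := (a :+ con 1ℚ :+ c) :* t) refl ∣ a′ ∣ τ (∣ c′ ∣ * Y) ⟩
        (∣ a′ ∣ + 1ℚ + ∣ c′ ∣ * Y) * τ                ∎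
        where open ≤-Reasoning

      -- Because Q (c x + d) = X + c (Q x - P). Set against the apartness of c α + d from 0, this
      -- will exclude X = 0.
      X≡0⇒small : 0ℚ ≤ Q′ → X ≡ ℤ.0ℤ → Q′ * ∣ c′ * x + d′ ∣ ≤ ∣ c′ ∣ * τ
      X≡0⇒small 0≤Q X≡0 = begin
        Q′ * ∣ c′ * x + d′ ∣                ≡⟨ cong (_* ∣ c′ * x + d′ ∣) (0≤p⇒∣p∣≡p 0≤Q) ⟨
        ∣ Q′ ∣ * ∣ c′ * x + d′ ∣            ≡⟨ ∣p*q∣≡∣p∣*∣q∣ Q′ (c′ * x + d′) ⟨
        ∣ Q′ * (c′ * x + d′) ∣              ≡⟨ cong ∣_∣ (solve 5 (λ c d P Q x → Q :* (c :* x :+ d)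
                                                 := (c :* P :+ d :* Q) :+ c :* (Q :* x :- P)) refl c′ d′ P′ Q′ x) ⟩
        ∣ (c′ * P′ + d′ * Q′) + c′ * (Q′ * x - P′) ∣
                                            ≡⟨ cong (λ t → ∣ t + c′ * (Q′ * x - P′) ∣) (trans (sym X′≡) (cong fromℤ X≡0)) ⟩
        ∣ 0ℚ + c′ * (Q′ * x - P′) ∣         ≡⟨ cong ∣_∣ (+-identityˡ (c′ * (Q′ * x - P′))) ⟩
        ∣ c′ * (Q′ * x - P′) ∣              ≤⟨ ∣*∣-mono-≤ {c′} ≤-refl Qx≈P ⟩
        ∣ c′ ∣ * τ                          ∎
        where open ≤-Reasoning

  -- Limits, roots and logarithms

  seq-^ : ∀ x n k → seq (x ℝ.^ n) k ≡ seq x k ^ n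
  seq-^ x zero    k = refl
  seq-^ x (suc n) k = cong (seq x k *_) (seq-^ x n k)

  -- Lets an estimate made at the single index k₀ carry over to all later terms.
  steady : ∀ x ε → 0ℚ < ε → Eventually λ k₀ → ∀ k → k₀ ℕ.≤ k → ∣ seq x k - seq x k₀ ∣ ≤ ε
  steady x ε 0<ε = let N , h = cauchy x ε 0<ε in
    N , λ k₀ k₀≥ k k≥ → <⇒≤ (h k k₀ (ℕ.≤-trans k₀≥ k≥) k₀≥)

  bounded : ∀ x → ∃[ b ] 0ℚ ≤ b × Eventually λ k → ∣ seq x k ∣ ≤ b
  bounded x = let N , h = steady x 1ℚ 0<1 in
    ∣ seq x N ∣ + 1ℚ , 0≤p+q (0≤∣p∣ (seq x N)) 0≤1 , N , λ k k≥ → begin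
      ∣ seq x k ∣                           ≡⟨ cong ∣_∣ (solve 2 (λ p q → p := q :+ (p :- q)) refl (seq x k) (seq x N)) ⟩
      ∣ seq x N + (seq x k - seq x N) ∣     ≤⟨ ∣+∣-mono-≤ {seq x N} ≤-refl (h N ℕ.≤-refl k k≥) ⟩
      ∣ seq x N ∣ + 1ℚ                      ∎
    where open ≤-Reasoning

  1/suc : ℕ → ℚ
  1/suc n = 1ℤ / suc n

  1/suc-* : ∀ n → 1/suc n * fromℕ (suc n) ≡ 1ℚ
  1/suc-* n = /-*-cancel 1ℤ (suc n)

  0≤1/suc : ∀ n → 0ℚ ≤ 1/suc n
  0≤1/suc n = nonNegative⁻¹ (1/suc n) {{normalize-nonNeg 1 (suc n)}}

  expApprox : ℚ → ℕ → ℚ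
  expApprox p n = (1ℚ + p * 1/suc n) ^ suc n

  log⇒close : ∀ y L → IsLog y L → ∀ ε → 0ℚ < ε →
    Eventually λ n → Eventually λ k → ∣ expApprox (seq L k) n - seq y k ∣ ≤ ε
  log⇒close y L h ε 0<ε = eventually-map
    (λ n → eventually-map (λ k → subst (λ t → ∣ t - seq y k ∣ ≤ ε)
      (seq-^ (ι 1ℚ ℝ.+ L ℝ.* ι (1ℤ / suc n)) (suc n) k)))
    (converges⇒close (λ n → (ι 1ℚ ℝ.+ L ℝ.* ι (1ℤ / suc n)) ℝ.^ suc n) y h ε 0<ε)

  -- Powers are monotone only on nonnegative bases, and 1 + L / (n + 1) may be negative for small n.
  -- It no longer is once n exceeds a bound for |L|.
  expBase-nonNeg : ∀ L → Eventually λ n → Eventually λ k → 0ℚ ≤ 1ℚ + seq L k * 1/suc n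
  expBase-nonNeg L =
    let b , 0≤b , ev = bounded L
        N , b≤N = archimedean b
    in N , λ n n≥ → eventually-map (λ k L≤b →
         ≤-by (1ℚ - (- (seq L k * 1/suc n))) (p≤q⇒0≤q-p (∣p∣≤⇒-p≤ {seq L k * 1/suc n} (begin
           ∣ seq L k * 1/suc n ∣        ≤⟨ ∣*∣-mono-≤ {seq L k} (≤-trans L≤b (≤-trans b≤N
                                             (fromℕ-mono-≤ (ℕ.≤-trans n≥ (ℕ.n≤1+n n)))))
                                             (≤-reflexive (0≤p⇒∣p∣≡p (0≤1/suc n))) ⟩
           fromℕ (suc n) * 1/suc n      ≡⟨ trans (*-comm (fromℕ (suc n)) (1/suc n)) (1/suc-* n) ⟩
           1ℚ                           ∎)))
           (solve 1 (λ t → con 0ℚ :+ (con 1ℚ :- (:- t)) := con 1ℚ :+ t) refl (seq L k * 1/suc n))) ev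
    where open ≤-Reasoning

  -- The terms of r are nonnegative only up to an arbitrary error. Taking that error to be ρ itself
  -- gives -ρ ≤ r, hence |r| ≤ ρ, and the sign of a term becomes irrelevant.
  root-upper : ∀ n d r ρ → IsRoot n (ι d) r → 0ℚ < ρ → Eventually (λ k → seq r k ≤ ρ) → d ≤ ρ ^ n
  root-upper n d r ρ (0≤r , r^n≃d) 0<ρ ev = p≤q+ε⇒p≤q λ ε 0<ε →
    eventually-const (eventually-map (λ k (r≤ρ , 0≤r+ρ , close) → begin
      d                      ≤⟨ ∣p-q∣≤⇒q≤p+ {seq (r ℝ.^ n) k} (<⇒≤ close) ⟩
      seq (r ℝ.^ n) k + ε    ≡⟨ cong (_+ ε) (seq-^ r n k) ⟩
      seq r k ^ n + ε        ≤⟨ +-monoˡ-≤ ε (p≤∣p∣ (seq r k ^ n)) ⟩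
      ∣ seq r k ^ n ∣ + ε    ≡⟨ cong (_+ ε) (∣^∣ (seq r k) n) ⟩
      ∣ seq r k ∣ ^ n + ε    ≤⟨ +-monoˡ-≤ ε (^-monoˡ-≤ n (0≤∣p∣ (seq r k)) (∣p∣≤ r≤ρ
                                  (≤-by (seq r k + ρ) 0≤r+ρ (solve 2 (λ r ρ → :- ρ :+ (r :+ ρ) := r) refl (seq r k) ρ)))) ⟩
      ρ ^ n + ε              ∎)
      (ev and 0≤r ρ 0<ρ and r^n≃d ε 0<ε))
    where open ≤-Reasoning

  root-lower : ∀ n d r ρ → IsRoot n (ι d) r → 0ℚ ≤ ρ → Eventually (λ k → ρ ≤ seq r k) → ρ ^ n ≤ d
  root-lower n d r ρ (_ , r^n≃d) 0≤ρ ev = p≤q+ε⇒p≤q λ ε 0<ε →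
    eventually-const (eventually-map (λ k (ρ≤r , close) → begin
      ρ ^ n                  ≤⟨ ^-monoˡ-≤ n 0≤ρ ρ≤r ⟩
      seq r k ^ n            ≡⟨ seq-^ r n k ⟨
      seq (r ℝ.^ n) k        ≤⟨ ∣p-q∣≤⇒p≤q+ {q = d} (<⇒≤ close) ⟩
      d + ε                  ∎)
      (ev and r^n≃d ε 0<ε))
    where open ≤-Reasoning

  module Roots (d : ℕ → ℚ) (1≤d : ∀ n → 1ℚ ≤ d n)
               (root : ℕ → ℝ) (isRoot : ∀ n → 1 ℕ.≤ n → IsRoot n (ι (d n)) (root n)) where

    limsup⇒≤ : ∀ M → IsLimsup root M → ∀ {ρ δ} → 0ℚ < ρ → 0ℚ < δ →
      Eventually (λ k → seq M k + δ ≤ ρ) → Eventually λ n → d n ≤ ρ ^ n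
    limsup⇒≤ M lim {ρ} {δ} 0<ρ 0<δ ev = eventually-map
      (λ n ((δ′ , 0<δ′ , ev′) , 1≤n) → root-upper n (d n) (root n) ρ (isRoot n 1≤n) 0<ρ
        (eventually-map (λ k (h , h′) → ≤-trans (p+δ≤q⇒p≤q 0<δ′ h′) h) (ev and ev′)))
      (proj₁ (lim δ 0<δ) and (1 , λ _ 1≤n → 1≤n))

    liminf⇒≤ : ∀ m → IsLiminf root m → ∀ {ρ δ} → 0ℚ ≤ ρ → 0ℚ < δ →
      Eventually (λ k → ρ + δ ≤ seq m k) → Eventually λ n → ρ ^ n ≤ d n
    liminf⇒≤ m lim {ρ} {δ} 0≤ρ 0<δ ev = eventually-map
      (λ n ((δ′ , 0<δ′ , ev′) , 1≤n) → root-lower n (d n) (root n) ρ (isRoot n 1≤n) 0≤ρ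
        (eventually-map (λ k (h , h′) → ≤-trans
          (≤-by (seq m k - (ρ + δ)) (p≤q⇒0≤q-p h)
            (solve 3 (λ ρ δ m → ρ :+ (m :- (ρ :+ δ)) := m :- δ) refl ρ δ (seq m k)))
          (p+δ≤q⇒p≤q 0<δ′ h′)) (ev and ev′)))
      (proj₁ (lim δ 0<δ) and (1 , λ _ 1≤n → 1≤n))

    -- A root at most ρ < 1 would give d n ≤ ρⁿ < 1. The case distinction is made on one rational
    -- term; one ε accounts for the later terms and one for the liminf.
    1≤liminf : ∀ m → IsLiminf root m → ∀ ε → 0ℚ < ε → Eventually λ k → 1ℚ ≤ seq m k + (ε + ε)
    1≤liminf m lim ε 0<ε = eventually-map bound-at (steady m ε 0<ε)
      where
      open ≤-Reasoning
      bound-at : ∀ k₀ → (∀ k → k₀ ℕ.≤ k → ∣ seq m k - seq m k₀ ∣ ≤ ε) → 1ℚ ≤ seq m k₀ + (ε + ε)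
      bound-at k₀ near with 1ℚ ≤? seq m k₀ + (ε + ε)
      ... | yes 1≤ = 1≤
      ... | no  1≰ with proj₂ (lim ε 0<ε) 1
      ...   | suc n , 1≤n , δ , 0<δ , ev = contradiction (begin-strict
              1ℚ               ≤⟨ 1≤d (suc n) ⟩
              d (suc n)        ≤⟨ root-upper (suc n) (d (suc n)) (root (suc n)) ρ (isRoot (suc n) 1≤n) 0<ρ
                                    (eventually-map (λ k (h , k≥) → begin
                                      seq (root (suc n)) k    ≤⟨ p+δ≤q⇒p≤q 0<δ h ⟩
                                      seq m k + ε             ≤⟨ +-monoˡ-≤ ε (∣p-q∣≤⇒p≤q+ {seq m k} (near k k≥)) ⟩
                                      seq m k₀ + ε + ε        ≡⟨ +-assoc (seq m k₀) ε ε ⟩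
                                      seq m k₀ + (ε + ε)      ≤⟨ p≤p⊔q (seq m k₀ + (ε + ε)) ½ ⟩
                                      ρ                       ∎) (ev and (k₀ , λ _ k≥ → k≥))) ⟩
              ρ * ρ ^ n        ≤⟨ *-monoˡ-≤ (<⇒≤ 0<ρ) (subst (ρ ^ n ≤_) (1^n≡1 n) (^-monoˡ-≤ n (<⇒≤ 0<ρ) (<⇒≤ ρ<1))) ⟩
              ρ * 1ℚ           ≡⟨ *-identityʳ ρ ⟩
              ρ                <⟨ ρ<1 ⟩
              1ℚ               ∎) (<-irrefl refl)
        where
        -- The ½ keeps ρ positive, as `root-upper` requires, and below 1.
        ρ = (seq m k₀ + (ε + ε)) ⊔ ½
        0<ρ : 0ℚ < ρ
        0<ρ = <-≤-trans 0<½ (p≤q⊔p (seq m k₀ + (ε + ε)) ½)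
        ρ<1 : ρ < 1ℚ
        ρ<1 with ⊔-sel (seq m k₀ + (ε + ε)) ½
        ... | inj₁ eq = subst (_< 1ℚ) (sym eq) (≰⇒> 1≰)
        ... | inj₂ eq = subst (_< 1ℚ) (sym eq) (<-by ½ 0<½ refl)

  -- If l ≤ -t, the approximants of exp l are at most 1 / (1 + t), against the lower bound 1 for m.
  log-positive : ∀ m l → IsLog m l → l # ι 0ℚ →
    (∀ ε → 0ℚ < ε → Eventually λ k → 1ℚ ≤ seq m k + (ε + ε)) →
    ∃[ t ] 0ℚ < t × Eventually λ k → t ≤ seq l k
  log-positive m l isLog (inj₂ (t , 0<t , ev)) 1≤m =
    t , 0<t , eventually-map (λ k → subst (_≤ seq l k) (+-identityˡ t)) ev
  log-positive m l isLog (inj₁ (t , 0<t , ev)) 1≤m =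
    let h = 1ℚ + t
        0<h = 0<p+q {1ℚ} 0<1 (<⇒≤ 0<t)
        r , 0<r , hr≡1 = reciprocal 0<h
        -- Chosen so that ε (1 + t) = t / 4. Three such errors occur, and 1 + 3 t / 4 is still below
        -- 1 + t.
        ε = t * ½ * ½ * r
        0<ε = 0<p*q (0<p*q (0<p*q 0<t 0<½) 0<½) 0<r
        ε*h≡ : ε * h ≡ t * ½ * ½
        ε*h≡ = trans (solve 3 (λ t r h → t :* r :* h := t :* (h :* r)) refl (t * ½ * ½) r h)
                 (trans (cong (t * ½ * ½ *_) hr≡1) (*-identityʳ (t * ½ * ½)))
        n , ev₁ , ev₂ = witness (log⇒close m l isLog ε 0<ε and expBase-nonNeg l)
    in contradiction
         (eventually-const (eventually-map
           (λ k (l+t≤0 , close , 0≤base , 1≤m+2ε) → let p = expApprox (seq l k) n in begin-strict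
             h                              ≡⟨ *-identityˡ h ⟨
             1ℚ * h                         ≤⟨ *-monoʳ-≤ (<⇒≤ 0<h) (≤-trans 1≤m+2ε
                                                 (+-monoˡ-≤ (ε + ε) (∣p-q∣≤⇒q≤p+ {p} close))) ⟩
             (p + ε + (ε + ε)) * h          ≡⟨ solve 3 (λ p ε h → (p :+ ε :+ (ε :+ ε)) :* h
                                                 := p :* h :+ (ε :* h :+ ε :* h :+ ε :* h)) refl p ε h ⟩
             p * h + (ε * h + ε * h + ε * h)
                                            ≡⟨ cong (λ x → p * h + (x + x + x)) ε*h≡ ⟩
             p * h + (t * ½ * ½ + t * ½ * ½ + t * ½ * ½)
                                            ≤⟨ +-monoˡ-≤ (t * ½ * ½ + t * ½ * ½ + t * ½ * ½)
                                                 ([1+pu]^n*[1+t]≤1 {seq l k} (suc n) (1/suc-* n)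
                                                   (0≤1/suc n) (<⇒≤ 0<t) 0≤base l+t≤0) ⟩
             1ℚ + (t * ½ * ½ + t * ½ * ½ + t * ½ * ½)
                                            <⟨ <-by (t * ½ * ½) (0<p*q (0<p*q 0<t 0<½) 0<½) (three-quarters t) ⟩
             h                              ∎)
           (ev and ev₁ and ev₂ and 1≤m ε 0<ε)))
         (<-irrefl refl)
    where
    open ≤-Reasoning
    three-quarters : ∀ t → 1ℚ + (t * ½ * ½ + t * ½ * ½ + t * ½ * ½) + t * ½ * ½ ≡ 1ℚ + t
    three-quarters = solve 1 (λ t → con 1ℚ :+ (t :* con ½ :* con ½ :+ t :* con ½ :* con ½ :+ t :* con ½ :* con ½)
      :+ t :* con ½ :* con ½ := con 1ℚ :+ t) refl

  -- The indices are predecessors of (j + 1)(b + 1) and (j + 1)(a + 1). After the outer powers both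
  -- sides have the same number of factors, so the comparison reduces to the bases and is exact.
  expApprox-compare : ∀ a b j {L l} → 0ℚ ≤ 1ℚ + L * 1/suc (b ℕ.+ j ℕ.* suc b) →
    fromℕ (suc a) * L ≤ fromℕ (suc b) * l →
    expApprox L (b ℕ.+ j ℕ.* suc b) ^ suc a ≤ expApprox l (a ℕ.+ j ℕ.* suc a) ^ suc b
  expApprox-compare a b j = exp-compare (suc a) (suc b) (suc j) (1/suc-* nB) (1/suc-* nA) (0≤1/suc nB) (0≤1/suc nA)
    where
    nB = b ℕ.+ j ℕ.* suc b
    nA = a ℕ.+ j ℕ.* suc a

  1+p≤expApprox : ∀ {p} n → 0ℚ ≤ p → 1ℚ + p ≤ expApprox p n
  1+p≤expApprox n = 1+p≤[1+pu]^n (suc n) (1/suc-* n) (0≤1/suc n)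

  -- Two errors ε lie between P and a later term of M, and likewise between p and a later term of m.
  -- With ε = η / 4 a third ε is available as the positive margin that `limsup⇒≤` and `liminf⇒≤`
  -- consume.
  approximants-separate : ∀ M m {P p η M′ m′} k → 0ℚ ≤ η → P + η ≤ M′ → m′ + η ≤ p →
    let ε = η * ½ * ½ in
    ∣ P - seq M k ∣ ≤ ε → ∣ p - seq m k ∣ ≤ ε →
    (∀ j → k ℕ.≤ j → ∣ seq M j - seq M k ∣ ≤ ε) → (∀ j → k ℕ.≤ j → ∣ seq m j - seq m k ∣ ≤ ε) →
    Eventually (λ j → seq M j + ε ≤ M′) × Eventually (λ j → m′ + ε ≤ seq m j)
  approximants-separate M m {P} {p} {η} {M′} {m′} k 0≤η P+η≤M′ m′+η≤p closeM closem steadyM steadym =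
      (k , λ j k≤j → begin
        seq M j + ε              ≤⟨ +-monoˡ-≤ ε (∣p-q∣≤⇒p≤q+ {seq M j} (steadyM j k≤j)) ⟩
        seq M k + ε + ε          ≤⟨ +-monoˡ-≤ ε (+-monoˡ-≤ ε (∣p-q∣≤⇒q≤p+ {P} closeM)) ⟩
        P + ε + ε + ε            ≤⟨ three-quarters P ⟩
        P + η                    ≤⟨ P+η≤M′ ⟩
        M′                       ∎)
    , (k , λ j k≤j → +-cancelʳ (begin
        m′ + ε + (ε + ε)         ≡⟨ solve 2 (λ m ε → m :+ ε :+ (ε :+ ε) := m :+ ε :+ ε :+ ε) refl m′ ε ⟩
        m′ + ε + ε + ε           ≤⟨ three-quarters m′ ⟩
        m′ + η                   ≤⟨ m′+η≤p ⟩
        p                        ≤⟨ ∣p-q∣≤⇒p≤q+ {p} closem ⟩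
        seq m k + ε              ≤⟨ +-monoˡ-≤ ε (∣p-q∣≤⇒q≤p+ {seq m j} (steadym j k≤j)) ⟩
        seq m j + ε + ε          ≡⟨ +-assoc (seq m j) ε ε ⟩
        seq m j + (ε + ε)        ∎))
    where
    open ≤-Reasoning
    ε = η * ½ * ½
    +-cancelʳ : ∀ {p q r} → p + r ≤ q + r → p ≤ q
    +-cancelʳ {p} {q} {r} h = ≤-by (q + r - (p + r)) (p≤q⇒0≤q-p h)
      (solve 3 (λ p q r → p :+ (q :+ r :- (p :+ r)) := q) refl p q r)
    three-quarters : ∀ p → p + ε + ε + ε ≤ p + η
    three-quarters p = ≤-by ε (0≤p*q (0≤p*q 0≤η (<⇒≤ 0<½)) (<⇒≤ 0<½))
      (solve 2 (λ p η → p :+ η :* con ½ :* con ½ :+ η :* con ½ :* con ½ :+ η :* con ½ :* con ½ :+ η :* con ½ :* con ½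
        := p :+ η) refl p η)

  -- The inequality between logarithms is transferred to approximants P of M and p of m with matched
  -- indices, which are then spread apart at the price of one exponent. The bound t ≤ l enters
  -- through p ≥ 1 + t, the room in which they are spread.
  log-separate : ∀ M m L l → IsLog M L → IsLog m l → ∀ a b →
    (∃[ t ] 0ℚ < t × Eventually λ k → t ≤ seq l k) →
    Eventually (λ k → fromℕ (suc a) * seq L k ≤ fromℕ (suc b) * seq l k) →
    ∃[ M′ ] ∃[ m′ ] ∃[ δ ] 1ℚ ≤ M′ × 1ℚ < m′ × 0ℚ < δ × M′ ^ suc a ≤ m′ ^ suc (suc b) ×
      Eventually (λ k → seq M k + δ ≤ M′) × Eventually (λ k → m′ + δ ≤ seq m k)
  log-separate M m L l logM logm a b (t , 0<t , t≤l) AL≤Bl = from-separation (separate (suc a) (suc b) 0<t)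
    where
    Goal : Set
    Goal = ∃[ M′ ] ∃[ m′ ] ∃[ δ ] 1ℚ ≤ M′ × 1ℚ < m′ × 0ℚ < δ × M′ ^ suc a ≤ m′ ^ suc (suc b) ×
      Eventually (λ k → seq M k + δ ≤ M′) × Eventually (λ k → m′ + δ ≤ seq m k)

    module _ {η} (0<η : 0ℚ < η)
      (sep : Separates (suc a) (suc b) t η) where

      ε = η * ½ * ½

      0<ε : 0ℚ < ε
      0<ε = 0<p*q (0<p*q 0<η 0<½) 0<½

      from-approximants : ∀ k P p → ∣ P - seq M k ∣ ≤ ε → ∣ p - seq m k ∣ ≤ ε →
        (∀ j → k ℕ.≤ j → ∣ seq M j - seq M k ∣ ≤ ε) → (∀ j → k ℕ.≤ j → ∣ seq m j - seq m k ∣ ≤ ε) →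
        0ℚ ≤ P → P ^ suc a ≤ p ^ suc b → 1ℚ + t ≤ p → Goal
      from-approximants k P p closeM closem steadyM steadym 0≤P P^≤p^ 1+t≤p with sep P p 0≤P P^≤p^ 1+t≤p
      ... | M′ , m′ , 1≤M′ , 1<m′ , M′^≤m′^ , P+η≤M′ , m′+η≤p = M′ , m′ , ε , 1≤M′ , 1<m′ , 0<ε , M′^≤m′^ ,
        approximants-separate M m {P} {m′ = m′} k (<⇒≤ 0<η) P+η≤M′ m′+η≤p closeM closem steadyM steadym

      from-index : ∀ j →
        Eventually (λ k → ∣ expApprox (seq L k) (b ℕ.+ j ℕ.* suc b) - seq M k ∣ ≤ ε) →
        Eventually (λ k → 0ℚ ≤ 1ℚ + seq L k * 1/suc (b ℕ.+ j ℕ.* suc b)) →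
        Eventually (λ k → ∣ expApprox (seq l k) (a ℕ.+ j ℕ.* suc a) - seq m k ∣ ≤ ε) → Goal
      from-index j ev₁ ev₂ ev₃ =
        let k , closeM , 0≤base , closem , t≤lk , AL≤Blk , steadyM , steadym =
              witness (ev₁ and ev₂ and ev₃ and t≤l and AL≤Bl and steady M ε 0<ε and steady m ε 0<ε)
        in from-approximants k _ _ closeM closem steadyM steadym (0≤^ (suc (b ℕ.+ j ℕ.* suc b)) 0≤base)
             (expApprox-compare a b j 0≤base AL≤Blk)
             (≤-trans (+-monoʳ-≤ 1ℚ t≤lk) (1+p≤expApprox (a ℕ.+ j ℕ.* suc a) (≤-trans (<⇒≤ 0<t) t≤lk)))

    multiple-≤ : ∀ j b → j ℕ.≤ b ℕ.+ j ℕ.* suc b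
    multiple-≤ j b = ℕ.≤-trans (ℕ.m≤m*n j (suc b)) (ℕ.m≤n+m (j ℕ.* suc b) b)

    from-separation : (∃[ η ] 0ℚ < η × Separates (suc a) (suc b) t η) → Goal
    from-separation (η , 0<η , sep) =
      let N₁ , close-M = log⇒close M L logM (ε 0<η sep) (0<ε 0<η sep) and expBase-nonNeg L
          N₂ , close-m = log⇒close m l logm (ε 0<η sep) (0<ε 0<η sep)
          j = N₁ ℕ.⊔ N₂
          ev₁ , ev₂ = close-M (b ℕ.+ j ℕ.* suc b) (ℕ.≤-trans (ℕ.m≤m⊔n N₁ N₂) (multiple-≤ j b))
      in from-index 0<η sep j ev₁ ev₂ (close-m (a ℕ.+ j ℕ.* suc a) (ℕ.≤-trans (ℕ.m≤n⊔m N₁ N₂) (multiple-≤ j a)))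

  -- ratio < B / A with A = 3 f c and B = (2 e + f) c - 2, where x = e / f and c
  -- is large in terms of the gap in the hypothesis.
  quotient-bound : ∀ (x : ℚ) e f .{{_ : ℕ.NonZero e}} .{{_ : ℕ.NonZero f}} → x * fromℕ f ≡ fromℕ e →
    ∀ logM logm ratio → IsQuotient logM logm ratio →
    ι ((+ 3) / 2) ℝ.* ratio ℝ.- ι ½ ℝ.< ι x →
    (∃[ t ] 0ℚ < t × Eventually λ k → t ≤ seq logm k) →
    ∃[ c ] ∃[ b ] suc (suc (suc b)) ≡ (2 ℕ.* e ℕ.+ f) ℕ.* suc c ×
      Eventually λ k → fromℕ (3 ℕ.* f ℕ.* suc c) * seq logM k ≤ fromℕ (suc b) * seq logm k
  quotient-bound x e f xf≡e logM logm ratio (_ , rl≃L) (δ , 0<δ , gap) (t , 0<t , t≤l) =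
    let r , 0<r , δr≡1 = reciprocal 0<δ
        -- This makes δ C ≥ 2. The gap multiplied by 2 f C is then at least 4, enough for the three
        -- units set aside in b.
        c , 2r≤c = archimedean (fromℕ 2 * r)
        C = fromℕ (suc c)
        T = 2 ℕ.* e ℕ.+ f
        3≤T = ℕ.+-mono-≤ (ℕ.*-monoʳ-≤ 2 (ℕ.>-nonZero⁻¹ e)) (ℕ.>-nonZero⁻¹ f)
        b = T ℕ.* suc c ℕ.∸ 3
        b≡ : 3 ℕ.+ b ≡ T ℕ.* suc c
        b≡ = ℕ.m+[n∸m]≡n (ℕ.≤-trans 3≤T (ℕ.m≤m*n T (suc c)))
        A = fromℕ (3 ℕ.* f ℕ.* suc c)
        s , 0<s , As≡1 = reciprocal (0<fromℕ (3 ℕ.* f ℕ.* suc c) {{ℕ.m*n≢0 (3 ℕ.* f) (suc c) {{ℕ.m*n≢0 3 f}}}})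
        2≤δC : fromℕ 2 ≤ δ * C
        2≤δC = begin
          fromℕ 2              ≡⟨ trans (sym (*-identityʳ (fromℕ 2))) (cong (fromℕ 2 *_) (sym δr≡1)) ⟩
          fromℕ 2 * (δ * r)    ≡⟨ solve 3 (λ a δ r → a :* (δ :* r) := δ :* (a :* r)) refl (fromℕ 2) δ r ⟩
          δ * (fromℕ 2 * r)    ≤⟨ *-monoˡ-≤ (<⇒≤ 0<δ) (≤-trans 2r≤c (fromℕ-mono-≤ (ℕ.n≤1+n c))) ⟩
          δ * C                ∎
    in c , b , b≡ , eventually-map (λ k (gap , t≤l , close) →
        estimate c b b≡ 2≤δC {seq ratio k} gap (<⇒≤ 0<t) t≤l
          (∣p-q∣≤⇒q≤p+ {seq ratio k * seq logm k} (<⇒≤ close))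
          (trans (solve 3 (λ A s t → A :* (s :* t) := (A :* s) :* t) refl A s t)
            (trans (cong (_* t) As≡1) (*-identityˡ t))))
        (gap and t≤l and rl≃L (s * t) (0<p*q 0<s 0<t))
    where
    open ≤-Reasoning
    F = fromℕ f
    estimate : ∀ c b → 3 ℕ.+ b ≡ (2 ℕ.* e ℕ.+ f) ℕ.* suc c → fromℕ 2 ≤ δ * fromℕ (suc c) →
      ∀ {ρ l L t ε} → ((+ 3) / 2) * ρ - ½ + δ ≤ x → 0ℚ ≤ t → t ≤ l → L ≤ ρ * l + ε →
      fromℕ (3 ℕ.* f ℕ.* suc c) * ε ≡ t → fromℕ (3 ℕ.* f ℕ.* suc c) * L ≤ fromℕ (suc b) * l
    estimate c b b≡ 2≤δC {ρ} {l} {L} {t} {ε} gap 0≤t t≤l L≤ Aε≡t = begin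
      A * L                   ≤⟨ *-monoˡ-≤ (0≤fromℕ (3 ℕ.* f ℕ.* suc c)) L≤ ⟩
      A * (ρ * l + ε)         ≡⟨ solve 4 (λ A ρ l ε → A :* (ρ :* l :+ ε) := A :* ρ :* l :+ A :* ε) refl A ρ l ε ⟩
      A * ρ * l + A * ε       ≡⟨ cong (λ u → A * ρ * l + u) Aε≡t ⟩
      -- One of the three units is spent here: the error A ε = t is at most l.
      A * ρ * l + t           ≤⟨ +-mono-≤ (*-monoʳ-≤ (≤-trans 0≤t t≤l) Aρ≤b) t≤l ⟩
      fromℕ b * l + l         ≡⟨ solve 2 (λ b l → b :* l :+ l := (con 1ℚ :+ b) :* l) refl (fromℕ b) l ⟩
      (1ℚ + fromℕ b) * l      ≡⟨ cong (_* l) (fromℕ-+ 1 b) ⟨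
      fromℕ (suc b) * l       ∎
      where
      A = fromℕ (3 ℕ.* f ℕ.* suc c)
      C = fromℕ (suc c)
      A≡ : A ≡ fromℕ 3 * F * C
      A≡ = trans (fromℕ-* (3 ℕ.* f) (suc c)) (cong (_* C) (fromℕ-* 3 f))
      b≡′ : fromℕ 3 + fromℕ b ≡ (fromℕ 2 * fromℕ e + F) * C
      b≡′ = trans (sym (fromℕ-+ 3 b)) (trans (cong fromℕ b≡) (trans (fromℕ-* (2 ℕ.* e ℕ.+ f) (suc c))
        (cong (_* C) (trans (fromℕ-+ (2 ℕ.* e) f) (cong (_+ F) (fromℕ-* 2 e))))))
      0≤2FC = 0≤p*q (0≤p*q (0≤fromℕ 2) (0≤fromℕ f)) (0≤fromℕ (suc c))
      -- The difference between b and A ρ as a sum of nonnegative terms: the hypothesis times 2 f C,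
      -- the surplus of δ C over 2, and 4 f - 3 written as 4 (f - 1) + 1.
      slack = fromℕ 2 * F * C * (x - (((+ 3) / 2) * ρ - ½ + δ))
                + (fromℕ 2 * F * (δ * C - fromℕ 2) + (fromℕ 4 * (F - 1ℚ) + 1ℚ))
      Aρ≤b : A * ρ ≤ fromℕ b
      Aρ≤b = ≤-by slack
        (0≤p+q (0≤p*q 0≤2FC (p≤q⇒0≤q-p gap))
          (0≤p+q (0≤p*q (0≤p*q (0≤fromℕ 2) (0≤fromℕ f)) (p≤q⇒0≤q-p 2≤δC))
            (0≤p+q (0≤p*q (0≤fromℕ 4) (p≤q⇒0≤q-p (1≤fromℕ f))) 0≤1)))
        (trans (cong (λ u → u * ρ + slack) A≡)
          (trans (solve 5 (λ F C x ρ δ → con (fromℕ 3) :* F :* C :* ρ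
              :+ (con (fromℕ 2) :* F :* C :* (x :- (con ((+ 3) / 2) :* ρ :- con ½ :+ δ))
                :+ (con (fromℕ 2) :* F :* (δ :* C :- con (fromℕ 2)) :+ (con (fromℕ 4) :* (F :- con 1ℚ) :+ con 1ℚ)))
              := (con (fromℕ 2) :* (x :* F) :+ F) :* C :- con (fromℕ 3)) refl F C x ρ δ)
          (trans (cong (λ u → (fromℕ 2 * u + F) * C - fromℕ 3) xf≡e)
            (trans (cong (_- fromℕ 3) (sym b≡′))
              (solve 2 (λ b t → t :+ b :- t := b) refl (fromℕ b) (fromℕ 3))))))

  -- Small values of q ‖qα‖ ‖qβ‖

  positive-fraction : ∀ x → 0ℚ < x → ∃[ e ] ∃[ f ] x * fromℕ (suc f) ≡ fromℕ (suc e)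
  positive-fraction x@(mkℚ (+ suc n) d _) 0<x = n , d , p*↧p≡↥p x
  positive-fraction (mkℚ (+ zero) _ _) 0<x with positive 0<x
  ... | ()
  positive-fraction (mkℚ -[1+ _ ] _ _) 0<x with positive 0<x
  ... | ()

  module _ (a : ℕ → ℕ) (a>0 : PositiveQuotients a) where
    open Approximation a a>0

    -- The exponent of m rises twice: A log M ≤ (b + 1) log m becomes M′ᴬ ≤ m′^(b + 2), and `growth`
    -- is applied with B = b + 2, one below the full exponent b + 3.
    den-growth : ∀ x e f → x * fromℕ (suc f) ≡ fromℕ (suc e) →
      (root : ℕ → ℝ) → (∀ l → 1 ℕ.≤ l → IsRoot l (ι (fromℕ (den a l))) (root l)) →
      ∀ M m → IsLimsup root M → IsLiminf root m →
      ∀ logM logm ratio → IsLog M logM → IsLog m logm → IsQuotient logM logm ratio →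
      ι ((+ 3) / 2) ℝ.* ratio ℝ.- ι ½ ℝ.< ι x →
      ∀ K → 0ℚ ≤ K → Eventually λ s → ∀ r → suc e ℕ.* r ℕ.≤ suc f ℕ.* s → K * q r ^ 3 ≤ q (r ℕ.+ (s ℕ.+ s))
    den-growth x e f x≡e/f root isRoot M m lim-M lim-m logM logm ratio isLogM isLogm isRatio gap K 0≤K =
      from-quotient (quotient-bound x (suc e) (suc f) x≡e/f logM logm ratio isRatio gap logm>0)
      where
      open Roots q 1≤q root isRoot
      logm>0 : ∃[ t ] 0ℚ < t × Eventually λ k → t ≤ seq logm k
      logm>0 = log-positive m logm isLogm (proj₁ isRatio) (1≤liminf m lim-m)

      Goal : Set
      Goal = Eventually λ s → ∀ r → suc e ℕ.* r ℕ.≤ suc f ℕ.* s → K * q r ^ 3 ≤ q (r ℕ.+ (s ℕ.+ s))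

      from-separation : ∀ c b → suc (suc (suc b)) ≡ (2 ℕ.* suc e ℕ.+ suc f) ℕ.* suc c →
        ∃[ M′ ] ∃[ m′ ] ∃[ δ ] 1ℚ ≤ M′ × 1ℚ < m′ × 0ℚ < δ × M′ ^ (3 ℕ.* suc f ℕ.* suc c) ≤ m′ ^ suc (suc b) ×
          Eventually (λ k → seq M k + δ ≤ M′) × Eventually (λ k → m′ + δ ≤ seq m k) → Goal
      from-separation c b b≡ (M′ , m′ , δ , 1≤M′ , 1<m′ , 0<δ , M′^≤m′^ , M<M′ , m′<m) =
        growth q 1≤q (λ m≤n → fromℕ-mono-≤ (den-mono-≤ a a>0 m≤n)) (suc e) (suc f) (suc c) (suc (suc b)) b≡
          1≤M′ 1<m′ M′^≤m′^
          (limsup⇒≤ M lim-M (<-≤-trans 0<1 1≤M′) 0<δ M<M′)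
          (liminf⇒≤ m lim-m (<⇒≤ (<-trans 0<1 1<m′)) 0<δ m′<m) K 0≤K

      from-quotient : (∃[ c ] ∃[ b ] suc (suc (suc b)) ≡ (2 ℕ.* suc e ℕ.+ suc f) ℕ.* suc c ×
        Eventually λ k → fromℕ (3 ℕ.* suc f ℕ.* suc c) * seq logM k ≤ fromℕ (suc b) * seq logm k) → Goal
      from-quotient (c , b , b≡ , AL≤Bl) = from-separation c b b≡
        (log-separate M m logM logm isLogM isLogm (ℕ.pred (3 ℕ.* suc f ℕ.* suc c)) b logm>0 AL≤Bl)

    combination-close : ∀ {u v w x} n → 0ℚ ≤ u → u ≤ w → 0ℚ ≤ v → v ≤ w →
      ∣ q (suc n) * x - p (suc n) ∣ * q (suc n) ≤ fromℕ 2 → ∣ q n * x - p n ∣ * q (suc n) ≤ fromℕ 2 →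
      ∣ (u * q (suc n) + v * q n) * x - (u * p (suc n) + v * p n) ∣ * q (suc n) ≤ fromℕ 4 * w
    combination-close {u} {v} {w} {x} n 0≤u u≤w 0≤v v≤w h₁ h₂ = begin
      ∣ (u * q₁ + v * q₀) * x - (u * p₁ + v * p₀) ∣ * q₁
        ≡⟨ cong (λ t → ∣ t ∣ * q₁) (solve 7 (λ u v q₁ q₀ p₁ p₀ x →
             (u :* q₁ :+ v :* q₀) :* x :- (u :* p₁ :+ v :* p₀) := u :* (q₁ :* x :- p₁) :+ v :* (q₀ :* x :- p₀))
             refl u v q₁ q₀ p₁ p₀ x) ⟩
      ∣ u * (q₁ * x - p₁) + v * (q₀ * x - p₀) ∣ * q₁
        ≤⟨ *-monoʳ-≤ (<⇒≤ (0<q (suc n))) (∣+∣-mono-≤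
             (∣*∣-mono-≤ {u} {q₁ * x - p₁} (≤-trans (≤-reflexive (0≤p⇒∣p∣≡p 0≤u)) u≤w) ≤-refl)
             (∣*∣-mono-≤ {v} {q₀ * x - p₀} (≤-trans (≤-reflexive (0≤p⇒∣p∣≡p 0≤v)) v≤w) ≤-refl)) ⟩
      (w * ∣ q₁ * x - p₁ ∣ + w * ∣ q₀ * x - p₀ ∣) * q₁
        ≡⟨ solve 4 (λ w s t z → (w :* s :+ w :* t) :* z := w :* (s :* z :+ t :* z))
             refl w ∣ q₁ * x - p₁ ∣ ∣ q₀ * x - p₀ ∣ q₁ ⟩
      w * (∣ q₁ * x - p₁ ∣ * q₁ + ∣ q₀ * x - p₀ ∣ * q₁)
        ≤⟨ *-monoˡ-≤ (≤-trans 0≤u u≤w) (+-mono-≤ h₁ h₂) ⟩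
      w * fromℕ 4
        ≡⟨ *-comm w (fromℕ 4) ⟩
      fromℕ 4 * w ∎
      where
      open ≤-Reasoning
      q₁ = q (suc n)
      q₀ = q n
      p₁ = p (suc n)
      p₀ = p n

    module Symmetric (r n : ℕ) (symmetric : SymmetricAt a r (suc n)) where

      Q P R : ℕ
      Q = den a r ℕ.* den a (suc n) ℕ.+ den⁻ a r ℕ.* den a n
      P = num a r ℕ.* den a (suc n) ℕ.+ num⁻ a r ℕ.* den a n
      R = num a r ℕ.* num a (suc n) ℕ.+ num⁻ a r ℕ.* num a n

      w z : ℚ
      w = q r
      z = q (suc n)

      0<z : 0ℚ < z
      0<z = 0<q (suc n)

      fromℕ-**+ : ∀ i j k l → fromℕ (i ℕ.* j ℕ.+ k ℕ.* l) ≡ fromℕ i * fromℕ j + fromℕ k * fromℕ l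
      fromℕ-**+ i j k l = trans (fromℕ-+ (i ℕ.* j) (k ℕ.* l)) (cong₂ _+_ (fromℕ-* i j) (fromℕ-* k l))

      -- P is first rewritten by the symmetry. A comparison of the original summands would need
      -- `num⁻ a r` ≤ `den⁻ a r`, which is false at r = 0.
      P≤Q : fromℕ P ≤ fromℕ Q
      P≤Q = fromℕ-mono-≤ (subst (ℕ._≤ Q) (sym symmetric) (ℕ.+-mono-≤
        (ℕ.*-monoʳ-≤ (den a r) (num≤den a a>0 (suc n))) (ℕ.*-monoʳ-≤ (den⁻ a r) (num≤den a a>0 n))))

      1≤Q : 1ℚ ≤ fromℕ Q
      1≤Q = fromℕ-mono-≤ {1} (ℕ.≤-trans (ℕ.*-mono-≤ (1≤den a a>0 r) (1≤den a a>0 (suc n))) (ℕ.m≤m+n _ (den⁻ a r ℕ.* den a n)))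

      Q≤2wz : fromℕ Q ≤ fromℕ 2 * w * z
      Q≤2wz = begin
        fromℕ Q                              ≡⟨ fromℕ-**+ (den a r) (den a (suc n)) (den⁻ a r) (den a n) ⟩
        w * z + fromℕ (den⁻ a r) * q n       ≤⟨ +-monoʳ-≤ (w * z) (*-mono-≤ (0≤fromℕ (den⁻ a r)) (fromℕ-mono-≤ (den⁻≤den a a>0 r))
                                                  (<⇒≤ (0<q n)) (fromℕ-mono-≤ (den≤den-suc a a>0 n))) ⟩
        w * z + w * z                        ≡⟨ solve 2 (λ w z → w :* z :+ w :* z := con (fromℕ 2) :* w :* z) refl w z ⟩
        fromℕ 2 * w * z                      ∎
        where open ≤-Reasoning

      Close : ℚ → Set
      Close x = ∣ fromℕ Q * x - fromℕ P ∣ * z ≤ fromℕ 4 * w × ∣ fromℕ P * x - fromℕ R ∣ * z ≤ fromℕ 4 * w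

      close : ∀ x → ∣ q (suc n) * x - p (suc n) ∣ * q (suc n) ≤ fromℕ 2 → ∣ q n * x - p n ∣ * q (suc n) ≤ fromℕ 2 → Close x
      close x h₁ h₂ =
        subst₂ (λ s t → ∣ s * x - t ∣ * z ≤ fromℕ 4 * w)
          (sym (fromℕ-**+ (den a r) (den a (suc n)) (den⁻ a r) (den a n)))
          (trans (sym (fromℕ-**+ (den a r) (num a (suc n)) (den⁻ a r) (num a n))) (cong fromℕ (sym symmetric)))
          (combination-close n (0≤fromℕ (den a r)) ≤-refl (0≤fromℕ (den⁻ a r)) (fromℕ-mono-≤ (den⁻≤den a a>0 r)) h₁ h₂) ,
        subst₂ (λ s t → ∣ s * x - t ∣ * z ≤ fromℕ 4 * w)
          (sym (fromℕ-**+ (num a r) (den a (suc n)) (num⁻ a r) (den a n)))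
          (sym (fromℕ-**+ (num a r) (num a (suc n)) (num⁻ a r) (num a n)))
          (combination-close n (0≤fromℕ (num a r)) (fromℕ-mono-≤ (num≤den a a>0 r))
            (0≤fromℕ (num⁻ a r)) (fromℕ-mono-≤ (num⁻≤den a a>0 r)) h₁ h₂)

      eventually-close : ∀ {α} → ℝ.Converges (λ n → ι (ℝ.convergent a a>0 n)) α → Eventually λ k → Close (seq α k)
      eventually-close {α} h = eventually-map
        (λ k (h₁ , h₂) → close (seq α k)
          -- At index n + 1 the available factor is q_{n+2}; it is weakened to q_{n+1} so that both
          -- convergents share one scale.
          (≤-trans (*-monoˡ-≤ (0≤∣p∣ (q (suc n) * seq α k - p (suc n))) (fromℕ-mono-≤ (den≤den-suc a a>0 (suc n)))) h₁) h₂)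
        (limit-close {α} h (suc n) and limit-close {α} h n)

  -- The constant 64 is twice 32: the product takes only half of ε, and the other half serves as the
  -- positive gap demanded by `_<_` on reals.
  scaled-product : ∀ {K S G Q τ ε X dx dy} → 0ℚ < K → 0ℚ ≤ S → 0ℚ ≤ G → 0ℚ ≤ X → 0ℚ ≤ dx → 0ℚ ≤ dy →
    X ≤ S * Q → dx ≤ S * τ → dy ≤ G * τ → K * (Q * τ * τ) ≤ fromℕ 32 → fromℕ 64 * (S * S * G) ≤ K * ε →
    X * dx * dy ≤ ε * ½
  scaled-product {K} {S} {G} {Q} {τ} {ε} {X} {dx} {dy}
    0<K 0≤S 0≤G 0≤X 0≤dx 0≤dy X≤ dx≤ dy≤ KQττ≤ ≤Kε = *-cancelˡ-≤ 0<K (begin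
    K * (X * dx * dy)                        ≤⟨ *-monoˡ-≤ (<⇒≤ 0<K) (*-mono-≤ (0≤p*q 0≤X 0≤dx) (*-mono-≤ 0≤X X≤ 0≤dx dx≤) 0≤dy dy≤) ⟩
    K * (S * Q * (S * τ) * (G * τ))          ≡⟨ solve 5 (λ K S G Q τ → K :* (S :* Q :* (S :* τ) :* (G :* τ))
                                                  := S :* S :* G :* (K :* (Q :* τ :* τ))) refl K S G Q τ ⟩
    S * S * G * (K * (Q * τ * τ))            ≤⟨ *-monoˡ-≤ (0≤p*q (0≤p*q 0≤S 0≤S) 0≤G) KQττ≤ ⟩
    S * S * G * fromℕ 32                     ≡⟨ solve 1 (λ t → t :* con (fromℕ 32) := con (fromℕ 64) :* t :* con ½) refl (S * S * G) ⟩
    fromℕ 64 * (S * S * G) * ½               ≤⟨ *-monoʳ-≤ (<⇒≤ 0<½) ≤Kε ⟩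
    K * ε * ½                                ≡⟨ *-assoc K ε ½ ⟩
    K * (ε * ½)                              ∎)
    where open ≤-Reasoning

  -- Here w = q_r, z = q_N and τ = 4 w / z, the latter kept in the form τ z = 4 w to avoid division.
  -- The computation is Q τ² ≤ 2 w z τ² = 8 w² τ = 32 w³ / z.
  module Scale {K w z τ} (0≤K : 0ℚ ≤ K) (1≤w : 1ℚ ≤ w) (0<z : 0ℚ < z) (0≤τ : 0ℚ ≤ τ)
               (τz≡4w : τ * z ≡ fromℕ 4 * w) (Kw³≤z : K * w ^ 3 ≤ z) where
    open ≤-Reasoning

    Kw²τ≤4 : K * w * w * τ ≤ fromℕ 4
    Kw²τ≤4 = *-cancelˡ-≤ 0<z (begin
      z * (K * w * w * τ)         ≡⟨ solve 4 (λ z K w τ → z :* (K :* w :* w :* τ) := K :* w :* w :* (τ :* z)) refl z K w τ ⟩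
      K * w * w * (τ * z)         ≡⟨ cong (K * w * w *_) τz≡4w ⟩
      K * w * w * (fromℕ 4 * w)   ≡⟨ solve 2 (λ K w → K :* w :* w :* (con (fromℕ 4) :* w)
                                       := con (fromℕ 4) :* (K :* (w :* (w :* (w :* con 1ℚ))))) refl K w ⟩
      fromℕ 4 * (K * w ^ 3)       ≤⟨ *-monoˡ-≤ (0≤fromℕ 4) Kw³≤z ⟩
      fromℕ 4 * z                 ≡⟨ *-comm (fromℕ 4) z ⟩
      z * fromℕ 4                 ∎)

    Kτ≤4 : K * τ ≤ fromℕ 4
    Kτ≤4 = begin
      K * τ                ≡⟨ cong (_* τ) (trans (sym (*-identityʳ K)) (sym (*-identityʳ (K * 1ℚ)))) ⟩
      K * 1ℚ * 1ℚ * τ      ≤⟨ *-monoʳ-≤ 0≤τ (*-mono-≤ (0≤p*q 0≤K 0≤1) (*-monoˡ-≤ 0≤K 1≤w) 0≤1 1≤w) ⟩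
      K * w * w * τ        ≤⟨ Kw²τ≤4 ⟩
      fromℕ 4              ∎

    KQττ≤32 : ∀ {Q} → Q ≤ fromℕ 2 * w * z → K * (Q * τ * τ) ≤ fromℕ 32
    KQττ≤32 {Q} Q≤ = begin
      K * (Q * τ * τ)                      ≤⟨ *-monoˡ-≤ 0≤K (*-monoʳ-≤ 0≤τ (*-monoʳ-≤ 0≤τ Q≤)) ⟩
      K * (fromℕ 2 * w * z * τ * τ)        ≡⟨ solve 5 (λ K w z τ t → K :* (t :* w :* z :* τ :* τ)
                                                := t :* K :* w :* (τ :* z) :* τ) refl K w z τ (fromℕ 2) ⟩
      fromℕ 2 * K * w * (τ * z) * τ        ≡⟨ cong (λ t → fromℕ 2 * K * w * t * τ) τz≡4w ⟩
      fromℕ 2 * K * w * (fromℕ 4 * w) * τ  ≡⟨ solve 3 (λ K w τ → con (fromℕ 2) :* K :* w :* (con (fromℕ 4) :* w) :* τ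
                                                := con (fromℕ 8) :* (K :* w :* w :* τ)) refl K w τ ⟩
      fromℕ 8 * (K * w * w * τ)            ≤⟨ *-monoˡ-≤ (0≤fromℕ 8) Kw²τ≤4 ⟩
      fromℕ 8 * fromℕ 4                    ∎

  #0⇒apart : ∀ x → x # ι 0ℚ → ∃[ δ ] 0ℚ < δ × Eventually λ k → δ ≤ ∣ seq x k ∣
  #0⇒apart x (inj₁ (δ , 0<δ , ev)) = δ , 0<δ , eventually-map (λ k h → subst (δ ≤_) (∣-p∣≡∣p∣ (seq x k))
    (≤-trans (≤-by (0ℚ - (seq x k + δ)) (p≤q⇒0≤q-p h)
      (solve 2 (λ x δ → δ :+ (con 0ℚ :- (x :+ δ)) := :- x) refl (seq x k) δ)) (p≤∣p∣ (- seq x k)))) ev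
  #0⇒apart x (inj₂ (δ , 0<δ , ev)) = δ , 0<δ , eventually-map (λ k h →
    ≤-trans (subst (_≤ seq x k) (+-identityˡ δ) h) (p≤∣p∣ (seq x k))) ev

  littlewood : ℝ → ℝ → ℕ → ℝ
  littlewood α β n = ι (fromℕ n) ℝ.* ∥ ι (fromℕ n) ℝ.* α ∥ ℝ.* ∥ ι (fromℕ n) ℝ.* β ∥

  module Homography (α β : ℝ) (a : ℕ → ℕ) (a>0 : PositiveQuotients a)
    (converges : ℝ.Converges (λ n → ι (ℝ.convergent a a>0 n)) α)
    (a′ b′ c′ d′ : ℤ)
    (homography : β ℝ.* (ι (fromℤ c′) ℝ.* α ℝ.+ ι (fromℤ d′)) ℝ.≃ ι (fromℤ a′) ℝ.* α ℝ.+ ι (fromℤ b′)) where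
    open Approximation a a>0

    ∣a∣ ∣c∣ S : ℚ
    ∣a∣ = ∣ fromℤ a′ ∣
    ∣c∣ = ∣ fromℤ c′ ∣
    S = ∣c∣ + ∣ fromℤ d′ ∣

    0≤S : 0ℚ ≤ S
    0≤S = 0≤p+q (0≤∣p∣ (fromℤ c′)) (0≤∣p∣ (fromℤ d′))

    -- K has two tasks: its bound against δ excludes X = 0, its bound against ε makes the product
    -- small. Both involve only the homography, α, β and ε, so K is available before the words are
    -- chosen.
    module _ {δ Y ε K} (0<ε : 0ℚ < ε) (0<K : 0ℚ < K) (0≤Y : 0ℚ ≤ Y)
      (δ≤ : Eventually λ k → δ ≤ ∣ fromℤ c′ * seq α k + fromℤ d′ ∣)
      (≤Y : Eventually λ k → ∣ seq β k ∣ ≤ Y)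
      (4c<Kδ : fromℕ 4 * ∣c∣ + 1ℚ ≤ K * δ)
      (64SSG≤Kε : fromℕ 64 * (S * S * (∣a∣ + 1ℚ + ∣c∣ * Y)) ≤ K * ε)
      (r n : ℕ)
      (symmetric : SymmetricAt a r (suc n))
      (Kq³≤q : K * q r ^ 3 ≤ q (suc n)) where

      open Symmetric a a>0 r n symmetric
      open Witness a′ b′ c′ d′ (+ P) (+ Q) (+ R) using (X; ∣X∣≤; dist-x; dist-y; X≡0⇒small)

      G : ℚ
      G = ∣a∣ + 1ℚ + ∣c∣ * Y

      0≤G : 0ℚ ≤ G
      0≤G = 0≤p+q (0≤p+q (0≤∣p∣ (fromℤ a′)) 0≤1) (0≤p*q (0≤∣p∣ (fromℤ c′)) 0≤Y)

      0<Q : 0ℚ < fromℕ Q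
      0<Q = <-≤-trans 0<1 1≤Q

      module _ {τ} (0<τ : 0ℚ < τ) (τz≡4w : τ * z ≡ fromℕ 4 * w) where
        open Scale {K} {w} {z} {τ} (<⇒≤ 0<K) (1≤q r) 0<z (<⇒≤ 0<τ) τz≡4w Kq³≤q

        z-cancel : ∀ {t} → t * z ≤ fromℕ 4 * w → t ≤ τ
        z-cancel {t} h = *-cancelʳ-≤-pos z {{positive 0<z}} (≤-trans h (≤-reflexive (sym τz≡4w)))

        close-τ : Eventually λ k → ∣ fromℕ Q * seq α k - fromℕ P ∣ ≤ τ × ∣ fromℕ P * seq α k - fromℕ R ∣ ≤ τ
        close-τ = eventually-map (λ k (h₁ , h₂) → z-cancel h₁ , z-cancel h₂) (eventually-close {α} converges)

        -- The equation defining β is taken to precision τ / Q, which the factor Q turns into τ.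
        homography-τ : Eventually λ k →
          ∣ fromℕ Q * (seq β k * (fromℤ c′ * seq α k + fromℤ d′) - (fromℤ a′ * seq α k + fromℤ b′)) ∣ ≤ τ
        homography-τ = from-reciprocal (reciprocal 0<Q)
          where
          from-reciprocal : ∃[ v ] 0ℚ < v × fromℕ Q * v ≡ 1ℚ → _
          from-reciprocal (v , 0<v , Qv≡1) = eventually-map (λ k h → ≤-trans
            (∣*∣-mono-≤ {fromℕ Q} (≤-reflexive (0≤p⇒∣p∣≡p (<⇒≤ 0<Q))) (<⇒≤ h))
            (≤-reflexive (trans (sym (*-assoc (fromℕ Q) v τ)) (trans (cong (_* τ) Qv≡1) (*-identityˡ τ)))))
            (homography (v * τ) (0<p*q 0<v 0<τ))

        X≢0 : X ≢ ℤ.0ℤ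
        X≢0 X≡0 = eventually-const (eventually-map (λ k ((Qx≈P , _) , δ≤) → contradiction (begin-strict
          fromℕ 4 * ∣c∣                      <⟨ p<p+q {fromℕ 4 * ∣c∣} 0<1 ⟩
          fromℕ 4 * ∣c∣ + 1ℚ                 ≤⟨ 4c<Kδ ⟩
          K * δ                              ≤⟨ *-monoˡ-≤ (<⇒≤ 0<K) δ≤ ⟩
          K * ∣ fromℤ c′ * seq α k + fromℤ d′ ∣
            ≡⟨ cong (K *_) (*-identityˡ ∣ fromℤ c′ * seq α k + fromℤ d′ ∣) ⟨
          K * (1ℚ * ∣ fromℤ c′ * seq α k + fromℤ d′ ∣)
            ≤⟨ *-monoˡ-≤ (<⇒≤ 0<K) (*-monoʳ-≤ (0≤∣p∣ (fromℤ c′ * seq α k + fromℤ d′)) 1≤Q) ⟩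
          K * (fromℕ Q * ∣ fromℤ c′ * seq α k + fromℤ d′ ∣)
            ≤⟨ *-monoˡ-≤ (<⇒≤ 0<K) (X≡0⇒small {seq α k} Qx≈P (<⇒≤ 0<Q) X≡0) ⟩
          K * (∣c∣ * τ)                      ≡⟨ solve 3 (λ K c τ → K :* (c :* τ) := K :* τ :* c) refl K ∣c∣ τ ⟩
          K * τ * ∣c∣                        ≤⟨ *-monoʳ-≤ (0≤∣p∣ (fromℤ c′)) Kτ≤4 ⟩
          fromℕ 4 * ∣c∣                      ∎) (<-irrefl refl)) (close-τ and δ≤))
          where open ≤-Reasoning

        1≤∣X∣ : 1 ℕ.≤ ℤ.∣ X ∣
        1≤∣X∣ = ℕ.n≢0⇒n>0 (λ ∣X∣≡0 → X≢0 (ℤ.∣i∣≡0⇒i≡0 ∣X∣≡0))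

        product-small : littlewood α β ℤ.∣ X ∣ ℝ.< ι 0ℚ ℝ.+ ι ε
        product-small = ε * ½ , 0<p*q 0<ε 0<½ , eventually-map (λ k ((Qx≈P , Px≈R) , y≈ , y≤Y) → begin
          fromℕ ℤ.∣ X ∣ * distℚ (fromℕ ℤ.∣ X ∣ * seq α k) * distℚ (fromℕ ℤ.∣ X ∣ * seq β k) + ε * ½
            ≤⟨ +-monoˡ-≤ (ε * ½) (scaled-product {K} {S} {G} {fromℕ Q} {τ} {ε} 0<K 0≤S 0≤G (0≤fromℕ ℤ.∣ X ∣)
                 (0≤distℚ (fromℕ ℤ.∣ X ∣ * seq α k)) (0≤distℚ (fromℕ ℤ.∣ X ∣ * seq β k))
                 (∣X∣≤ (0≤fromℕ P) P≤Q) (dist-x {seq α k} Qx≈P Px≈R) (dist-y {seq α k} Qx≈P {seq β k} y≤Y y≈)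
                 (KQττ≤32 Q≤2wz) 64SSG≤Kε) ⟩
          ε * ½ + ε * ½      ≡⟨ half+half ε ⟩
          ε                  ≡⟨ +-identityˡ ε ⟨
          0ℚ + ε             ∎)
          (close-τ and homography-τ and ≤Y)
          where
          open ≤-Reasoning
          0≤distℚ : ∀ p → 0ℚ ≤ distℚ p
          0≤distℚ p = 0≤∣p∣ (p - fromℤ (round p))

      small-value : ∃[ N ] 1 ℕ.≤ N × littlewood α β N ℝ.< ι 0ℚ ℝ.+ ι ε
      small-value = from-reciprocal (reciprocal 0<z)
        where
        from-reciprocal : ∃[ v ] 0ℚ < v × z * v ≡ 1ℚ → ∃[ N ] 1 ℕ.≤ N × littlewood α β N ℝ.< ι 0ℚ ℝ.+ ι ε
        from-reciprocal (v , 0<v , zv≡1) = ℤ.∣ X ∣ , 1≤∣X∣ 0<τ τz≡4w , product-small 0<τ τz≡4w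
          where
          τ = fromℕ 4 * w * v
          0<τ : 0ℚ < τ
          0<τ = 0<p*q (0<p*q (0<fromℕ 4) (0<q r)) 0<v
          τz≡4w : τ * z ≡ fromℕ 4 * w
          τz≡4w = trans (solve 3 (λ t v z → t :* v :* z := t :* (z :* v)) refl (fromℕ 4 * w) v z)
            (trans (cong (fromℕ 4 * w *_) zv≡1) (*-identityʳ (fromℕ 4 * w)))

  0≤littlewood : ∀ α β n → ι 0ℚ ℝ.≤ littlewood α β n
  0≤littlewood α β n ε 0<ε = 0 , λ k _ → 0≤p+q (0≤p*q (0≤p*q (0≤fromℕ n)
    (0≤∣p∣ (fromℕ n * seq α k - fromℤ (round (fromℕ n * seq α k)))))
    (0≤∣p∣ (fromℕ n * seq β k - fromℤ (round (fromℕ n * seq β k))))) (<⇒≤ 0<ε)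

  large-scale : ∀ {δ ε c t} → 0ℚ < δ → 0ℚ < ε → 0ℚ ≤ c → 0ℚ ≤ t → ∃[ K ] 0ℚ < K × c + 1ℚ ≤ K * δ × t ≤ K * ε
  large-scale {δ} {ε} {c} {t} 0<δ 0<ε 0≤c 0≤t =
    let u , 0<u , δu≡1 = reciprocal 0<δ
        v , 0<v , εv≡1 = reciprocal 0<ε
        K₁ = (c + 1ℚ) * u
        K₂ = t * v
        0<K₁ = 0<p*q (subst (0ℚ <_) (+-comm 1ℚ c) (0<p+q {1ℚ} 0<1 0≤c)) 0<u
        0≤K₂ = 0≤p*q 0≤t (<⇒≤ 0<v)
    in K₁ + K₂ , 0<p+q 0<K₁ 0≤K₂
     , ≤-trans (≤-reflexive (absorb (c + 1ℚ) δu≡1)) (*-monoʳ-≤ (<⇒≤ 0<δ) (p≤p+q {K₁} 0≤K₂))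
     , ≤-trans (≤-reflexive (absorb t εv≡1)) (*-monoʳ-≤ (<⇒≤ 0<ε)
         (subst (K₂ ≤_) (+-comm K₂ K₁) (p≤p+q {K₂} (<⇒≤ 0<K₁))))
    where
    absorb : ∀ s {p r} → p * r ≡ 1ℚ → s ≡ s * r * p
    absorb s {p} {r} pr≡1 = trans (sym (*-identityʳ s)) (trans (cong (s *_) (sym pr≡1))
      (solve 3 (λ s p r → s :* (p :* r) := s :* r :* p) refl s p r))

  -- Choice of a long palindrome and of the scale.

  length-unbounded : ∀ (f : ℕ → ℕ) → (∀ k → 1 ℕ.≤ k → f k ℕ.< f (suc k)) → ∀ n → n ℕ.≤ f (suc n)
  length-unbounded f f< zero    = ℕ.z≤n
  length-unbounded f f< (suc n) = ℕ.≤-<-trans (length-unbounded f f< n) (f< (suc n) (ℕ.s≤s ℕ.z≤n))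

  length-ratio : ∀ x e f r s → x * fromℕ f ≡ fromℕ e → x * fromℕ r ≤ fromℕ s → e ℕ.* r ℕ.≤ f ℕ.* s
  length-ratio x e f r s xf≡e xr≤s = fromℕ-cancel-≤ (begin
    fromℕ (e ℕ.* r)            ≡⟨ fromℕ-* e r ⟩
    fromℕ e * fromℕ r          ≡⟨ cong (_* fromℕ r) xf≡e ⟨
    x * fromℕ f * fromℕ r      ≡⟨ solve 3 (λ x f r → x :* f :* r := f :* (x :* r)) refl x (fromℕ f) (fromℕ r) ⟩
    fromℕ f * (x * fromℕ r)    ≤⟨ *-monoˡ-≤ (0≤fromℕ f) xr≤s ⟩
    fromℕ f * fromℕ s          ≡⟨ fromℕ-* f s ⟨
    fromℕ (f ℕ.* s)            ∎)
    where open ≤-Reasoning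

  module _ (α β : ℝ) (a : ℕ → ℕ) (isCF : IsContinuedFraction a α) (x : ℚ)
    (U V : ℕ → List ℕ)
    (begins : ∀ k → 1 ℕ.≤ k → BeginsWith a (V k ++ U k ++ reverse (U k)))
    (increasing : ∀ k → 1 ℕ.≤ k → length (U k) ℕ.< length (U (suc k)))
    (x∣V∣≤∣U∣ : ∀ k → 1 ℕ.≤ k → x * fromℕ (length (V k)) ≤ fromℕ (length (U k)))
    (e f : ℕ) (xf≡e : x * fromℕ (suc f) ≡ fromℕ (suc e))
    (growing : ∀ K → 0ℚ ≤ K → Eventually λ s → ∀ r → suc e ℕ.* r ℕ.≤ suc f ℕ.* s →
      K * fromℕ (den a r) ^ 3 ≤ fromℕ (den a (r ℕ.+ (s ℕ.+ s)))) where

    -- The index r + 2s is written as a successor, so that the preceding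
    -- convergent can be named.
    at-index : ∀ {K} r s N → r ℕ.+ (s ℕ.+ s) ≡ N → 1 ℕ.≤ s →
      SymmetricAt a r N →
      K * fromℕ (den a r) ^ 3 ≤ fromℕ (den a N) →
      ∃[ n ] SymmetricAt a r (suc n)
        × K * fromℕ (den a r) ^ 3 ≤ fromℕ (den a (suc n))
    at-index r s zero    eq 1≤s _ _ = contradiction
      (ℕ.≤-trans 1≤s (ℕ.≤-trans (ℕ.m≤m+n s s) (ℕ.≤-trans (ℕ.m≤n+m (s ℕ.+ s) r) (ℕ.≤-reflexive eq)))) λ ()
    at-index r s (suc n) eq 1≤s symmetric K≤ = n , symmetric , K≤

    littlewood-small : EqualUpToHomography β α → ∀ ε → 0ℚ < ε → ∃[ N ] 1 ℕ.≤ N × littlewood α β N ℝ.< ι 0ℚ ℝ.+ ι ε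
    littlewood-small (a′ , b′ , c′ , d′ , _ , apart , homography) ε 0<ε =
      from-bounds (#0⇒apart (ι (fromℤ c′) ℝ.* α ℝ.+ ι (fromℤ d′)) apart) (bounded β)
      where
      Goal : Set
      Goal = ∃[ N ] 1 ℕ.≤ N × littlewood α β N ℝ.< ι 0ℚ ℝ.+ ι ε
      open Homography α β a (proj₁ isCF) (proj₂ isCF) a′ b′ c′ d′ homography

      from-bounds : (∃[ δ ] 0ℚ < δ × Eventually λ k → δ ≤ ∣ fromℤ c′ * seq α k + fromℤ d′ ∣) →
        (∃[ Y ] 0ℚ ≤ Y × Eventually λ k → ∣ seq β k ∣ ≤ Y) → Goal
      from-bounds (δ , 0<δ , δ≤) (Y , 0≤Y , ≤Y) = from-scale (large-scale {δ} {ε} 0<δ 0<ε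
          (0≤p*q (0≤fromℕ 4) (0≤∣p∣ (fromℤ c′)))
          (0≤p*q (0≤fromℕ 64) (0≤p*q (0≤p*q 0≤S 0≤S)
            (0≤p+q (0≤p+q (0≤∣p∣ (fromℤ a′)) 0≤1) (0≤p*q (0≤∣p∣ (fromℤ c′)) 0≤Y)))))
        where
        from-scale : (∃[ K ] 0ℚ < K × fromℕ 4 * ∣c∣ + 1ℚ ≤ K * δ
          × fromℕ 64 * (S * S * (∣a∣ + 1ℚ + ∣c∣ * Y)) ≤ K * ε) → Goal
        from-scale (K , 0<K , 4c<Kδ , 64SSG≤Kε) = from-growth (growing K (<⇒≤ 0<K))
          where
          from-growth : (Eventually λ s → ∀ r → suc e ℕ.* r ℕ.≤ suc f ℕ.* s →
            K * fromℕ (den a r) ^ 3 ≤ fromℕ (den a (r ℕ.+ (s ℕ.+ s)))) → Goal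
          from-growth (s₀ , large) =
            -- Lengths are controlled from index 1 on, so this k gives s ≥ s₀ + 1: beyond the
            -- threshold for growth, and positive, as `at-index` requires.
            let k = suc (suc s₀)
                1≤k = ℕ.s≤s ℕ.z≤n
                r = length (V k)
                s = length (U k)
                suc-s₀≤s = length-unbounded (λ k → length (U k)) increasing (suc s₀)
                n , symmetric , Kq³≤q = at-index {K} r s (r ℕ.+ (s ℕ.+ s)) refl (ℕ.≤-trans (ℕ.s≤s ℕ.z≤n) suc-s₀≤s)
                  (palindrome-symmetry a (V k) (U k) (begins k 1≤k))
                  (large s (ℕ.≤-trans (ℕ.n≤1+n s₀) suc-s₀≤s) r
                    (length-ratio x (suc e) (suc f) r s xf≡e (x∣V∣≤∣U∣ k 1≤k)))
            in small-value {δ} {Y} 0<ε 0<K 0≤Y δ≤ ≤Y 4c<Kδ 64SSG≤Kε r n symmetric Kq³≤q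

-- The infimum is zero.

open import Defs
open Estimates using
  (littlewood; 0≤littlewood; littlewood-small; positive-fraction; den-growth)

theorem5 :
  (α : ℝ) (a : ℕ → ℕ) → IsContinuedFraction a α → Bad α →
  (x : ℚ) → 0ℚ ℚ.< x →
  (U V : ℕ → List ℕ) →
  (∀ k → 1 ℕ.≤ k → IsWord (U k)) →
  (∀ k → 1 ℕ.≤ k → IsWord (V k)) →
  (∀ k → 1 ℕ.≤ k → BeginsWith a (V k ++ U k ++ reverse (U k))) →
  (∀ k → 1 ℕ.≤ k → length (U k) ℕ.< length (U (suc k))) →
  (∀ k → 1 ℕ.≤ k → x ℚ.* fromℕ (length (V k)) ℚ.≤ fromℕ (length (U k))) →
  (root : ℕ → ℝ) → (∀ l → 1 ℕ.≤ l → IsRoot l (ι (fromℕ (den a l))) (root l)) →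
  (M m : ℝ) → IsLimsup root M → IsLiminf root m →
  (logM logm ratio : ℝ) →
  IsLog M logM → IsLog m logm → IsQuotient logM logm ratio →
  ι ((+ 3) ℚ./ 2) * ratio - ι ½ < ι x →
  (β : ℝ) → EqualUpToHomography β α →
  IsInf (λ n → ι (fromℕ n) * ∥ ι (fromℕ n) * α ∥ * ∥ ι (fromℕ n) * β ∥) (ι 0ℚ)
theorem5 α a isCF _ x 0<x U V _ _ begins increasing x∣V∣≤∣U∣ root isRoot M m lim-M lim-m
  logM logm ratio isLogM isLogm isRatio gap β homographic =
  (λ n _ → 0≤littlewood α β n) , from-fraction (positive-fraction x 0<x)
  where
  from-fraction : (∃[ e ] ∃[ f ] x ℚ.* fromℕ (suc f) ≡ fromℕ (suc e)) →
    ∀ ε → 0ℚ ℚ.< ε → ∃[ N ] 1 ℕ.≤ N × littlewood α β N < ι 0ℚ + ι ε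
  from-fraction (e , f , xf≡e) =
    littlewood-small α β a isCF x U V begins increasing x∣V∣≤∣U∣ e f xf≡e
      (den-growth a (proj₁ isCF) x e f xf≡e root isRoot M m lim-M lim-m
        logM logm ratio isLogM isLogm isRatio gap)
      homographic
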